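{- Let $p\in\{a,e\}^*$ be any pattern and $\otimes\in\{\mathrm{del},\mathrm{add},\mathrm{edit}\}$. Then $p\text{ - }\textsc{RM}^{\otimes}_{\mathrm{mon}}(p)\subseteq\mathrm{para}\text{ - }\mathrm{AC}^0$.
   Context: A monadic vocabulary $\tau=\{R_1,\dots,R_r\}$ has only unary relation symbols; a finite $\tau$-structure is $\mathcal A=(A,R_1^{\mathcal A},\dots,R_r^{\mathcal A})$ with $R_i^{\mathcal A}\subseteq A$ (ordered). A modulator is $S=(S_1,\dots,S_r)$ with $S_i\subseteq A$; deletion modulator if $S_i\subseteq R_i^{\mathcal A}$, addition modulator if $S_i\cap R_i^{\mathcal A}=\emptyset$; $\mathcal A\triangleright S=(A,R_1^{\mathcal A}\triangle S_1,\dots)$, $\|S\|=\sum_i|S_i|$. For a first-order $\tau$-sentence $\phi$ in prenex form, $p\text{ - }\textsc{RM}^{\mathrm{edit}}_{\mathrm{mon}}(\phi)$: given $\mathcal A$ and parameter $k$, is there a modulator $S$ with $\|S\|\le k$ and $\mathcal A\triangleright S\models\phi$; del/add versions require a deletion/addition modulator. The pattern of $\phi$ is the word over $\{a,e\}$ recording its quantifier prefix ($a$ for $\forall$, $e$ for $\exists$); $p\text{ - }\textsc{RM}^{\otimes}_{\mathrm{mon}}(p)$ is the class of all such problems (over any monadic vocabulary) for sentences with pattern $p$. $\mathrm{para}\text{ - }\mathrm{AC}^0$: parameterized problems decided by unbounded fan-in and/or/not circuit families of constant depth and size $f(k)n^{O(1)}$, $f$ computable. -}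

module Defs where

open import Data.Bool.Base using (Bool; true; not; _xor_)
open import Data.Bool.ListAction using (all; any)
open import Data.Empty using () renaming (⊥ to Empty)
open import Data.Fin.Base using (Fin)
open import Data.Fin.Subset using (Subset; _∈_; _⊆_; _∩_; ∣_∣) renaming (⊤ to full; ⊥ to ∅)
open import Data.List.Base as List using (List; []; _∷_)
open import Data.List.Extrema.Nat using (max)
open import Data.Nat.Base using (ℕ; suc; _+_; _*_; _^_; _≤_; _<_; _⊔_)
open import Data.Product.Base using (Σ-syntax; ∃; ∃-syntax; _×_; _,_)
open import Data.Sum.Base using (_⊎_; inj₁; inj₂)
open import Data.Unit.Base using () renaming (⊤ to Unit)
open import Data.Vec.Base as Vec using (Vec; []; _∷_; lookup; zipWith)
open import Data.Vec.Relation.Binary.Pointwise.Inductive using (Pointwise)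
open import Function.Bundles using (_⇔_)
open import Level using (0ℓ)
open import Relation.Binary.PropositionalEquality.Core using (_≡_)
open import Relation.Nullary.Negation.Core using (¬_)
open import Relation.Unary using (Pred; _≐_) renaming (_∈_ to _∈ᴾ_)

------------------------------------------------------------------------
-- Monadic structures and modulators

-- A monadic vocabulary {R₁, …, R_r} is given by its number r of symbols, and
-- the universe of a finite structure is taken to be Fin n.  The empty
-- universe is allowed; it contributes only the empty encoding below.

Structure : ℕ → ℕ → Set
Structure r n = Vec (Subset n) r

Modulator : ℕ → ℕ → Set
Modulator r n = Vec (Subset n) r

infixl 6 _△_
_△_ : ∀ {n} → Subset n → Subset n → Subset n
_△_ = zipWith _xor_

infixl 6 _▷_
_▷_ : ∀ {r n} → Structure r n → Modulator r n → Structure r n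
_▷_ = zipWith _△_

∥_∥ : ∀ {r n} → Modulator r n → ℕ
∥ S ∥ = Vec.sum (Vec.map ∣_∣ S)

data Mode : Set where
  del add edit : Mode

Admissible : Mode → ∀ {r n} → Structure r n → Modulator r n → Set
Admissible del  A S = ∀ i → lookup S i ⊆ lookup A i
Admissible add  A S = ∀ i → lookup S i ∩ lookup A i ≡ ∅
Admissible edit A S = Unit

------------------------------------------------------------------------
-- First-order logic with equality: prenex formulas over r unary relation
-- symbols, with free variables in Fin m

data QuantifierFree (r m : ℕ) : Set where
  rel       : Fin r → Fin m → QuantifierFree r m
  _≈̇_       : Fin m → Fin m → QuantifierFree r m
  ⊤̇ ⊥̇       : QuantifierFree r m
  ¬̇_        : QuantifierFree r m → QuantifierFree r m
  _∧̇_ _∨̇_   : QuantifierFree r m → QuantifierFree r m → QuantifierFree r m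

data Prenex (r m : ℕ) : Set where
  matrix : QuantifierFree r m → Prenex r m
  ∀̇_ ∃̇_  : Prenex r (suc m) → Prenex r m

Sentence : ℕ → Set
Sentence r = Prenex r 0

-- a stands for ∀ and e for ∃.
data Letter : Set where
  a e : Letter

Pattern : Set
Pattern = List Letter

pattern-of : ∀ {r m} → Prenex r m → Pattern
pattern-of (matrix _) = []
pattern-of (∀̇ φ)      = a ∷ pattern-of φ
pattern-of (∃̇ φ)      = e ∷ pattern-of φ

SatQF : ∀ {r n m} → Structure r n → Vec (Fin n) m → QuantifierFree r m → Set
SatQF A ρ (rel i x) = lookup ρ x ∈ lookup A i
SatQF A ρ (x ≈̇ y)   = lookup ρ x ≡ lookup ρ y
SatQF A ρ ⊤̇         = Unit
SatQF A ρ ⊥̇         = Empty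
SatQF A ρ (¬̇ ψ)     = ¬ SatQF A ρ ψ
SatQF A ρ (ψ ∧̇ χ)   = SatQF A ρ ψ × SatQF A ρ χ
SatQF A ρ (ψ ∨̇ χ)   = SatQF A ρ ψ ⊎ SatQF A ρ χ

Sat : ∀ {r n m} → Structure r n → Vec (Fin n) m → Prenex r m → Set
Sat A ρ (matrix ψ) = SatQF A ρ ψ
Sat A ρ (∀̇ φ)      = ∀ v → Sat A (v ∷ ρ) φ
Sat A ρ (∃̇ φ)      = ∃[ v ] Sat A (v ∷ ρ) φ

infix 4 _⊨_
_⊨_ : ∀ {r n} → Structure r n → Sentence r → Set
A ⊨ φ = Sat A [] φ

------------------------------------------------------------------------
-- Parameterized problems and relation modification

ParaProblem : Set₁
ParaProblem = Pred (List Bool × ℕ) 0ℓ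

-- The string 1ⁿ followed by the characteristic strings of R₁, …, R_r.  The
-- leading block keeps the encoding injective when r = 0.
encode : ∀ {r n} → Structure r n → List Bool
encode A = Vec.toList (Vec.concat (full ∷ A))

RM-problem : ∀ {r} → Mode → Sentence r → ParaProblem
RM-problem {r} ⊗ φ (x , k) =
  Σ[ n ∈ ℕ ] Σ[ A ∈ Structure r n ] x ≡ encode A ×
  (Σ[ S ∈ Modulator r n ] Admissible ⊗ A S × ∥ S ∥ ≤ k × A ▷ S ⊨ φ)

p-RM-mon : Mode → Pattern → Pred ParaProblem 0ℓ
p-RM-mon ⊗ p Q =
  Σ[ r ∈ ℕ ] Σ[ φ ∈ Sentence r ] pattern-of φ ≡ p × Q ≐ RM-problem ⊗ φ

------------------------------------------------------------------------
-- Computable functions: the μ-recursive functions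

data Rec : ℕ → Set where
  zer  : Rec 0
  succ : Rec 1
  proj : ∀ {n} → Fin n → Rec n
  comp : ∀ {m n} → Rec m → Vec (Rec n) m → Rec n
  prim : ∀ {n} → Rec n → Rec (2 + n) → Rec (suc n)
  mu   : ∀ {n} → Rec (suc n) → Rec n

-- g [ xs ]⇓ y : the partial function described by g is defined at xs, with
-- value y.
infix 4 _[_]⇓_
data _[_]⇓_ : ∀ {n} → Rec n → Vec ℕ n → ℕ → Set where
  zer   : zer [ [] ]⇓ 0
  succ  : ∀ {x} → succ [ x ∷ [] ]⇓ suc x
  proj  : ∀ {n} {xs : Vec ℕ n} i → proj i [ xs ]⇓ lookup xs i
  comp  : ∀ {m n} {g : Rec m} {hs : Vec (Rec n) m} {xs ys z} →
          Pointwise (λ h y → h [ xs ]⇓ y) hs ys → g [ ys ]⇓ z →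
          comp g hs [ xs ]⇓ z
  prim₀ : ∀ {n} {g : Rec n} {h xs y} →
          g [ xs ]⇓ y → prim g h [ 0 ∷ xs ]⇓ y
  primₛ : ∀ {n} {g : Rec n} {h xs t y z} →
          prim g h [ t ∷ xs ]⇓ y → h [ t ∷ y ∷ xs ]⇓ z →
          prim g h [ suc t ∷ xs ]⇓ z
  mu    : ∀ {n} {g : Rec (suc n)} {xs t} →
          (∀ {s} → s < t → ∃[ y ] g [ s ∷ xs ]⇓ suc y) →
          g [ t ∷ xs ]⇓ 0 → mu g [ xs ]⇓ t

Computable : (ℕ → ℕ) → Set
Computable f = Σ[ g ∈ Rec 1 ] (∀ k → g [ k ∷ [] ]⇓ f k)

------------------------------------------------------------------------
-- Boolean circuits with gates of unbounded fan-in

-- Gates are listed in reverse topological order, so a gate sees the n inputs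
-- and the m gates after it in the list; gate 0 is the nearest of these.  Fan-out
-- is unrestricted: circuits are acyclic graphs, not just formulas.

data Wire (n m : ℕ) : Set where
  input : Fin n → Wire n m
  gate  : Fin m → Wire n m

data Gate (n m : ℕ) : Set where
  AND OR : List (Wire n m) → Gate n m
  NOT    : Wire n m → Gate n m

data Gates (n : ℕ) : ℕ → Set where
  []  : Gates n 0
  _∷_ : ∀ {m} → Gate n m → Gates n m → Gates n (suc m)

record Circuit (n : ℕ) : Set where
  constructor circuit
  field
    {size} : ℕ
    gates  : Gates n size
    output : Wire n size

open Circuit public using (size)

wire-value : ∀ {n m} → (Fin n → Bool) → Vec Bool m → Wire n m → Bool
wire-value x vs (input i) = x i
wire-value x vs (gate j)  = lookup vs j

gate-value : ∀ {n m} → (Fin n → Bool) → Vec Bool m → Gate n m → Bool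
gate-value x vs (AND ws) = all (wire-value x vs) ws
gate-value x vs (OR ws)  = any (wire-value x vs) ws
gate-value x vs (NOT w)  = not (wire-value x vs w)

gate-values : ∀ {n m} → (Fin n → Bool) → Gates n m → Vec Bool m
gate-values x []       = []
gate-values x (g ∷ gs) = gate-value x (gate-values x gs) g ∷ gate-values x gs

eval : ∀ {n} → Circuit n → (Fin n → Bool) → Bool
eval (circuit gs out) x = wire-value x (gate-values x gs) out

wire-depth : ∀ {n m} → Vec ℕ m → Wire n m → ℕ
wire-depth ds (input i) = 0
wire-depth ds (gate j)  = lookup ds j

gate-depth : ∀ {n m} → Vec ℕ m → Gate n m → ℕ
gate-depth ds (AND ws) = suc (max 0 (List.map (wire-depth ds) ws))
gate-depth ds (OR ws)  = suc (max 0 (List.map (wire-depth ds) ws))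
gate-depth ds (NOT w)  = suc (wire-depth ds w)

gate-depths : ∀ {n m} → Gates n m → Vec ℕ m
gate-depths []       = []
gate-depths (g ∷ gs) = gate-depth (gate-depths gs) g ∷ gate-depths gs

-- Every gate counts, including negations and gates not leading to the output.
depth : ∀ {n} → Circuit n → ℕ
depth (circuit gs _) = Vec.foldr′ _⊔_ 0 (gate-depths gs)

-- The bound uses suc n instead of n only so that it does not vanish for the
-- empty input; for n ≥ 1 the factor 2 ^ c gained is absorbed by f.
para-AC⁰ : Pred ParaProblem 0ℓ
para-AC⁰ Q =
  Σ[ C ∈ (∀ n → ℕ → Circuit n) ] Σ[ d ∈ ℕ ] Σ[ c ∈ ℕ ] Σ[ f ∈ (ℕ → ℕ) ]
    Computable f ×
    (∀ n k → depth (C n k) ≤ d × size (C n k) ≤ f k * suc n ^ c) ×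
    (∀ x k → (x , k) ∈ᴾ Q ⇔ eval (C (List.length x) k) (List.lookup x) ≡ true)

{-# OPTIONS --safe #-}
module Submission where

-- With t moves to go, first-order sentences cannot distinguish two monadic structures
-- in which every colour (the set of relations holding at an element) occurs equally
-- often up to the threshold t, and a single change of a relation at one element costs
-- one more move.  So whether ≤ k changes make φ true depends only on the colour
-- frequencies truncated at k + (number of quantifiers of φ), and it can be read off the
-- structure that realises the truncated frequencies.
--
-- A circuit of constant depth tests "at least t elements" by perfect hashing: t distinct
-- elements of {0,…,n−1} are separated by a decision tree with t leaves querying bits of
-- their binary codes.  There are (log n)^O_t(1) ≤ f(t)·n such trees, and the circuit
-- guesses one of them and checks that every leaf is reached.

open import Defs
open import Data.Bool.Base using (Bool; true; false; not; _∧_; _xor_; if_then_else_)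
open import Data.Bool.ListAction using (all; any; and; or)
import Data.Bool.Properties as Bool
open import Data.Bool.Properties using (∧-assoc; ∧-comm)
open import Data.Fin.Base using (Fin; zero; suc; finToFun; funToFin; combine; inject≤; cast)
open import Data.Fin.Patterns using (0F; 1F; 2F)
open import Data.Fin.Properties using (any?; all?; funToFin-finToFin; inject≤-injective; ¬∀⟶∃¬)
import Data.Fin.Properties as Fin
import Data.Fin.Subset as Subset
open import Data.Fin.Subset using (Subset; ∣_∣)
open import Data.Fin.Subset.Properties using (∉⊥; x∈p∩q⁺; x∈p∩q⁻; Empty-unique)
open import Data.List.Base as List using
  (List; []; _∷_; _++_; length; map; concatMap; replicate; cartesianProduct; cartesianProductWith; allFin; upTo)
open import Data.List.Extrema.Nat using (max; max<v⁺)
open import Data.List.Membership.Propositional using (_∈_)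
open import Data.List.Membership.Propositional.Properties using
  (∈-cartesianProduct⁺; ∈-cartesianProduct⁻; ∈-cartesianProductWith⁺; ∈-cartesianProductWith⁻;
   ∈-allFin; ∈-upTo⁺; ∈-upTo⁻; ∈-++⁺ˡ; ∈-++⁺ʳ; ∈-map⁺; ∈-map⁻)
open import Data.List.Properties using (length-++; length-map; length-tabulate; length-upTo)
open import Data.List.Relation.Unary.All as All using (All; []; _∷_)
import Data.List.Relation.Unary.All.Properties as All
open import Data.List.Relation.Unary.AllPairs using ([]; _∷_)
open import Data.List.Relation.Unary.Any using (here; there)
open import Data.List.Relation.Unary.Unique.Propositional using (Unique)
import Data.List.Relation.Unary.Unique.Propositional.Properties as Unique
open import Data.Nat.Base
open import Data.Nat.Divisibility using (_∣_; _∣?_; divides)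
open import Data.Nat.Properties
open import Data.Nat.Tactic.RingSolver using (solve-∀)
open import Data.Product.Base as Product using (Σ-syntax; ∃-syntax; ∃₂; _×_; _,_; proj₁; proj₂)
open import Data.Sum.Base using (_⊎_; inj₁; inj₂)
open import Data.Unit.Base using (⊤; tt)
open import Data.Vec.Base as Vec using (Vec; []; _∷_; lookup; tabulate; updateAt; toList; fromList; concat)
open import Data.Vec.Properties using
  (≡-dec; []=⇒lookup; lookup⇒[]=; lookup-map; lookup-zipWith; lookup-replicate; lookup-concat;
   lookup∘updateAt; lookup∘updateAt′; lookup∘tabulate; tabulate∘lookup; tabulate-cong;
   ∷-injectiveʳ; toList∘fromList; toList-cast; length-toList)
open import Data.Vec.Relation.Binary.Pointwise.Inductive using ([]; _∷_)
open import Function.Base using (_∘_; const; id)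
open import Function.Bundles using (_⇔_; mk⇔; Equivalence)
open import Relation.Binary.Definitions using (tri<; tri≈; tri>)
open import Relation.Binary.PropositionalEquality
open import Relation.Nullary
open import Relation.Nullary.Decidable using (map′; dec-true; dec-false)
open import Relation.Unary using (_⊆_)

-- Counting, and thresholds by binary decision trees

-- What shapes the proof is that neither the depth nor the exponent of n may depend on k. Guessing t
-- elements outright would cost n to the power t; guessing a tree costs only a power of log n, and
-- x^j is at most (2j)^j times 2^x, which for x near log n is linear in n up to a factor depending
-- on j alone. The leaf regions of a tree are sets fixed together with n, so the depth of the tree,
-- which grows with k, never turns into circuit depth. The circuit does not evaluate φ either. Once
-- the truncated frequencies are guessed, the representative is one concrete finite structure;
-- `solvable?` settles it while the circuit is being written down, and the answer enters as a
-- constant. The frequencies are guessed colour by colour, so the depth grows with the number 2^r of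
-- colours, which is fixed by the vocabulary. Modulators are recast as sequences of toggles so that
-- modifications and quantifiers become moves of one and the same game.

𝟙 : Bool → ℕ
𝟙 b = if b then 1 else 0

count : ∀ {n} → (Fin n → Bool) → ℕ
count {zero}  f = 0
count {suc n} f = 𝟙 (f zero) + count (f ∘ suc)

count-cong : ∀ {n} {f g : Fin n → Bool} → f ≗ g → count f ≡ count g
count-cong {zero}  f≗g = refl
count-cong {suc n} f≗g = cong₂ (λ b c → 𝟙 b + c) (f≗g zero) (count-cong (f≗g ∘ suc))

infixl 6 _∖_
_∖_ : ∀ {n} → (Fin n → Bool) → Fin n → Fin n → Bool
(f ∖ v) w = not (does (v Fin.≟ w)) ∧ f w

∖-removed : ∀ {n} (f : Fin n → Bool) v → (f ∖ v) v ≡ false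
∖-removed f v rewrite dec-true (v Fin.≟ v) refl = refl

∖-kept : ∀ {n} (f : Fin n → Bool) {v w} → v ≢ w → (f ∖ v) w ≡ f w
∖-kept f {v} {w} v≢w rewrite dec-false (v Fin.≟ w) v≢w = refl

∖-true : ∀ {n} (f : Fin n → Bool) {v w} → (f ∖ v) w ≡ true → v ≢ w × f w ≡ true
∖-true f {v} {w} fw with v Fin.≟ w
... | no v≢w = v≢w , fw

count-∖ : ∀ {n} (f : Fin n → Bool) v → count f ≡ 𝟙 (f v) + count (f ∖ v)
count-∖ {suc n} f zero    = refl
count-∖ {suc n} f (suc v) = begin
  𝟙 (f zero) + count (f ∘ suc)
    ≡⟨ cong (𝟙 (f zero) +_) (count-∖ (f ∘ suc) v) ⟩
  𝟙 (f zero) + (𝟙 (f (suc v)) + count ((f ∘ suc) ∖ v))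
    ≡⟨ sym (+-assoc (𝟙 (f zero)) _ _) ⟩
  𝟙 (f zero) + 𝟙 (f (suc v)) + count ((f ∘ suc) ∖ v)
    ≡⟨ cong (_+ count ((f ∘ suc) ∖ v)) (+-comm (𝟙 (f zero)) _) ⟩
  𝟙 (f (suc v)) + 𝟙 (f zero) + count ((f ∘ suc) ∖ v)
    ≡⟨ +-assoc (𝟙 (f (suc v))) _ _ ⟩
  𝟙 (f (suc v)) + (𝟙 (f zero) + count ((f ∘ suc) ∖ v)) ∎
  where open ≡-Reasoning

count-split : ∀ {n} (f g : Fin n → Bool) →
              count f ≡ count (λ v → g v ∧ f v) + count (λ v → not (g v) ∧ f v)
count-split {zero}  f g = refl
count-split {suc n} f g with g zero
... | true  = trans (cong (𝟙 (f zero) +_) (count-split (f ∘ suc) (g ∘ suc)))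
                    (sym (+-assoc (𝟙 (f zero)) _ _))
... | false = begin
  𝟙 (f zero) + count (f ∘ suc)  ≡⟨ cong (𝟙 (f zero) +_) (count-split (f ∘ suc) (g ∘ suc)) ⟩
  𝟙 (f zero) + (A + B)          ≡⟨ cong (𝟙 (f zero) +_) (+-comm A B) ⟩
  𝟙 (f zero) + (B + A)          ≡⟨ sym (+-assoc (𝟙 (f zero)) B A) ⟩
  𝟙 (f zero) + B + A            ≡⟨ +-comm (𝟙 (f zero) + B) A ⟩
  A + (𝟙 (f zero) + B)          ∎
  where
  open ≡-Reasoning
  A = count (λ v → g (suc v) ∧ f (suc v))
  B = count (λ v → not (g (suc v)) ∧ f (suc v))

count-pos⁻ : ∀ {n} (f : Fin n → Bool) → 1 ≤ count f → ∃[ v ] f v ≡ true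
count-pos⁻ {suc n} f 1≤ with f zero in eq
... | true  = zero , eq
... | false with v , fv ← count-pos⁻ (f ∘ suc) 1≤ = suc v , fv

count-pos⁺ : ∀ {n} (f : Fin n → Bool) {v} → f v ≡ true → 1 ≤ count f
count-pos⁺ f {v} fv rewrite count-∖ f v | fv = s≤s z≤n

count-two : ∀ {n} (f : Fin n → Bool) → 2 ≤ count f →
            ∃₂ λ v w → v ≢ w × f v ≡ true × f w ≡ true
count-two f 2≤
  with v , fv ← count-pos⁻ f (≤-trans (s≤s z≤n) 2≤)
  with w , f∖w ← count-pos⁻ (f ∖ v) (≤-pred (subst (2 ≤_) (trans (count-∖ f v) (cong (λ b → 𝟙 b + count (f ∖ v)) fv)) 2≤))
  with v≢w , fw ← ∖-true f f∖w
  = v , w , v≢w , fv , fw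

-- Shares a demand of t + 2 leaves between the two sides of a query, the first side taking as much
-- as it can. Both shares are positive, hence both are smaller than the demand, and subtrees of
-- depth one less can serve them.
+-split : ∀ {t m n} → 1 ≤ m → 1 ≤ n → suc (suc t) ≤ m + n →
          ∃₂ λ p q → p + q ≡ t × suc p ≤ m × suc q ≤ n
+-split {t} {suc m} {suc n} _ _ le with ≤-total t m
... | inj₁ t≤m = t , 0 , +-identityʳ t , s≤s t≤m , s≤s z≤n
... | inj₂ m≤t = m , t ∸ m , m+[n∸m]≡n m≤t , ≤-refl
               , s≤s (m≤n+o⇒m∸n≤o t m (≤-pred (≤-pred (subst (suc (suc t) ≤_) (+-suc (suc m) n) le))))

length-cartesianProductWith : ∀ {A B C : Set} (f : A → B → C) xs ys →
  length (cartesianProductWith f xs ys) ≡ length xs * length ys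
length-cartesianProductWith f []       ys = refl
length-cartesianProductWith f (x ∷ xs) ys =
  trans (length-++ (map (f x) ys)) (cong₂ _+_ (length-map (f x) ys) (length-cartesianProductWith f xs ys))

-- A set known when the circuit is built: membership is a constant there, not something to be
-- computed from the input.
Region : ℕ → Set
Region n = Fin n → Bool

module _ {n L : ℕ} (bit : Fin L → Region n) where

  -- The leaves of the tree that queries bit `i` at its root and continues with the trees of `F` and
  -- `G` on answers true and false.
  refine : Fin L → List (Region n) → List (Region n) → List (Region n)
  refine i F G = map (λ g v → bit i v ∧ g v) F ++ map (λ g v → not (bit i v) ∧ g v) G

  -- Each member lists the leaf regions of one of the partial decision trees of depth at most d.
  splittings : ℕ → List (List (Region n))
  splittings zero    = [] ∷ []
  splittings (suc d) = [] ∷ (const true ∷ []) ∷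
    cartesianProductWith (λ i (F , G) → refine i F G) (allFin L)
      (cartesianProduct (splittings d) (splittings d))

  Meets : (Fin n → Bool) → Region n → Set
  Meets f g = ∃[ v ] g v ∧ f v ≡ true

  -- The leaves of a tree are disjoint, so different leaves are met in different elements.
  -- Disjointness is never formulated: `push` moves the root query from the regions into `f`, and
  -- `count-split` adds the two halves.
  meets-all⇒length≤count : ∀ d {F} → F ∈ splittings d → ∀ f → All (Meets f) F → length F ≤ count f
  meets-all⇒length≤count zero    (here refl)         f ms             = z≤n
  meets-all⇒length≤count (suc d) (here refl)         f ms             = z≤n
  meets-all⇒length≤count (suc d) (there (here refl)) f ((v , fv) ∷ _) = count-pos⁺ f fv
  meets-all⇒length≤count (suc d) (there (there F∈))  f ms
    with i , (F , G) , _ , FG∈ , refl ← ∈-cartesianProductWith⁻ _ (allFin L) _ F∈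
    with F∈ , G∈ ← ∈-cartesianProduct⁻ (splittings d) (splittings d) FG∈
    with msF , msG ← All.++⁻ (map _ F) ms
    = begin
    length (refine i F G)         ≡⟨ length-++ (map _ F) ⟩
    length (map _ F) + length (map _ G)
      ≡⟨ cong₂ _+_ (length-map _ F) (length-map _ G) ⟩
    length F + length G
      ≤⟨ +-mono-≤
           (meets-all⇒length≤count d F∈ _ (All.map (push (bit i)) (All.map⁻ msF)))
           (meets-all⇒length≤count d G∈ _ (All.map (push (not ∘ bit i)) (All.map⁻ msG))) ⟩
    count (λ v → bit i v ∧ f v) + count (λ v → not (bit i v) ∧ f v)
      ≡⟨ sym (count-split f (bit i)) ⟩
    count f                       ∎
    where
    open ≤-Reasoning
    push : ∀ b {g} → Meets f (λ v → b v ∧ g v) → Meets (λ v → b v ∧ f v) g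
    push b {g} (v , eq) = v , trans (trans (sym (∧-assoc (g v) (b v) (f v)))
                                          (cong (_∧ f v) (∧-comm (g v) (b v)))) eq

  Separating : Set
  Separating = ∀ {v w} → v ≢ w → ∃[ i ] bit i v ≢ bit i w

  separate : Separating → ∀ f → 2 ≤ count f →
             ∃[ i ] 1 ≤ count (λ v → bit i v ∧ f v) × 1 ≤ count (λ v → not (bit i v) ∧ f v)
  separate sep f 2≤
    with v , w , v≢w , fv , fw ← count-two f 2≤
    with i , bv≢bw ← sep v≢w
    with bit i v in bv | bit i w in bw
  ... | true  | true  = contradiction refl bv≢bw
  ... | false | false = contradiction refl bv≢bw
  ... | true  | false = i , count-pos⁺ _ {v} (cong₂ _∧_ bv fv) , count-pos⁺ _ {w} (cong₂ _∧_ (cong not bw) fw)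
  ... | false | true  = i , count-pos⁺ _ {w} (cong₂ _∧_ bw fw) , count-pos⁺ _ {v} (cong₂ _∧_ (cong not bv) fv)

  -- Every query is chosen with elements of `f` on both sides, so a tree with t leaves makes fewer
  -- than t queries along a branch. This is why depth t suffices, however many bits there are.
  meeting-splitting : Separating → ∀ d f {t} → t ≤ d → t ≤ count f →
                      ∃[ F ] F ∈ splittings d × length F ≡ t × All (Meets f) F
  meeting-splitting sep zero    f {zero} _ _ = [] , here refl , refl , []
  meeting-splitting sep (suc d) f {zero} _ _ = [] , here refl , refl , []
  meeting-splitting sep (suc d) f {suc zero} _ 1≤
    with v , fv ← count-pos⁻ f 1≤
    = _ , there (here refl) , refl , (v , fv) ∷ []
  meeting-splitting sep (suc d) f {suc (suc t)} t≤d t≤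
    with i , 1≤m , 1≤n ← separate sep f (≤-trans (s≤s (s≤s z≤n)) t≤)
    with p , q , refl , p≤m , q≤n ← +-split 1≤m 1≤n (subst (suc (suc t) ≤_) (count-split f (bit i)) t≤)
    with F , F∈ , F≡ , msF ← meeting-splitting sep d (λ v → bit i v ∧ f v)
           (≤-trans (s≤s (m≤m+n p q)) (≤-pred t≤d)) p≤m
    with G , G∈ , G≡ , msG ← meeting-splitting sep d (λ v → not (bit i v) ∧ f v)
           (≤-trans (s≤s (m≤n+m q p)) (≤-pred t≤d)) q≤n
    = refine i F G
    , there (there (∈-cartesianProductWith⁺ _ (∈-allFin i) (∈-cartesianProduct⁺ F∈ G∈)))
    , (begin
        length (refine i F G)               ≡⟨ length-++ (map _ F) ⟩
        length (map _ F) + length (map _ G) ≡⟨ cong₂ _+_ (length-map _ F) (length-map _ G) ⟩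
        length F + length G                 ≡⟨ cong₂ _+_ F≡ G≡ ⟩
        suc p + suc q                       ≡⟨ cong suc (+-suc p q) ⟩
        suc (suc (p + q))                   ∎)
    , All.++⁺ (All.map⁺ (All.map (pull (bit i)) msF)) (All.map⁺ (All.map (pull (not ∘ bit i)) msG))
    where
    open ≡-Reasoning
    pull : ∀ b {g} → Meets (λ v → b v ∧ f v) g → Meets f (λ v → b v ∧ g v)
    pull b {g} (v , eq) = v , trans (sym (trans (sym (∧-assoc (g v) (b v) (f v)))
                                               (cong (_∧ f v) (∧-comm (g v) (b v))))) eq

  length-member≤ : ∀ d {F} → F ∈ splittings d → length F ≤ 2 ^ d
  length-member≤ zero    (here refl)         = z≤n
  length-member≤ (suc d) (here refl)         = z≤n
  length-member≤ (suc d) (there (here refl)) = m^n>0 2 (suc d)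
  length-member≤ (suc d) (there (there F∈))
    with i , (F , G) , _ , FG∈ , refl ← ∈-cartesianProductWith⁻ _ (allFin L) _ F∈
    with F∈ , G∈ ← ∈-cartesianProduct⁻ (splittings d) (splittings d) FG∈
    = begin
    length (refine i F G)               ≡⟨ length-++ (map _ F) ⟩
    length (map _ F) + length (map _ G) ≡⟨ cong₂ _+_ (length-map _ F) (length-map _ G) ⟩
    length F + length G                 ≤⟨ +-mono-≤ (length-member≤ d F∈) (length-member≤ d G∈) ⟩
    2 ^ d + 2 ^ d                       ≡⟨ cong (2 ^ d +_) (sym (+-identityʳ (2 ^ d))) ⟩
    2 ^ suc d                           ∎
    where open ≤-Reasoning

  -- The lengths s obey the recursion s ↦ 2 + L s². Since 2 ≤ 2 s², the product s (2 + L) at most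
  -- squares at each level, which yields the exponent 2 ^ d; `bound` carries this extra factor
  -- through the induction.
  length-splittings : ∀ d → length (splittings d) ≤ (2 + L) ^ (2 ^ d)
  length-splittings d = ≤-trans (m≤m*n (length (splittings d)) (2 + L)) (bound d)
    where
    open ≤-Reasoning
    nonempty : ∀ d → 1 ≤ length (splittings d)
    nonempty zero    = s≤s z≤n
    nonempty (suc d) = s≤s z≤n
    bound : ∀ d → length (splittings d) * (2 + L) ≤ (2 + L) ^ (2 ^ d)
    bound zero    = ≤-reflexive (*-comm 1 (2 + L))
    bound (suc d) = begin
      length (splittings (suc d)) * (2 + L)
        ≡⟨ cong (λ l → (2 + l) * (2 + L)) (trans (length-cartesianProductWith _ (allFin L) _)
             (cong₂ _*_ (length-tabulate {n = L} (λ i → i)) (length-cartesianProductWith _,_ S S))) ⟩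
      (2 + L * (s * s)) * (2 + L)
        ≤⟨ *-monoˡ-≤ (2 + L) (+-monoˡ-≤ (L * (s * s)) (*-monoʳ-≤ 2 (*-mono-≤ (nonempty d) (nonempty d)))) ⟩
      (2 * (s * s) + L * (s * s)) * (2 + L)
        ≡⟨ rearrange s L ⟩
      (s * (2 + L)) * (s * (2 + L))
        ≤⟨ *-mono-≤ (bound d) (bound d) ⟩
      (2 + L) ^ (2 ^ d) * (2 + L) ^ (2 ^ d)
        ≡⟨ sym (^-distribˡ-+-* (2 + L) (2 ^ d) (2 ^ d)) ⟩
      (2 + L) ^ (2 ^ d + 2 ^ d)
        ≡⟨ cong (λ j → (2 + L) ^ (2 ^ d + j)) (sym (+-identityʳ (2 ^ d))) ⟩
      (2 + L) ^ (2 ^ suc d) ∎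
      where
      S = splittings d
      s = length S
      rearrange : ∀ s L → (2 * (s * s) + L * (s * s)) * (2 + L) ≡ (s * (2 + L)) * (s * (2 + L))
      rearrange = solve-∀

-- 2 ^ L ≤ 2 * suc n keeps L logarithmic in n.
log : ∀ n → ∃[ L ] n ≤ 2 ^ L × 2 ^ L ≤ 2 * suc n
log zero = 0 , z≤n , s≤s z≤n
log (suc n) with L , n≤ , ≤n ← log n with m≤n⇒m<n∨m≡n n≤
... | inj₁ n< = L , n< , ≤-trans ≤n (*-monoʳ-≤ 2 (n≤1+n (suc n)))
... | inj₂ n≡ = suc L
              , subst (λ m → suc m ≤ 2 * 2 ^ L) (sym n≡) (subst (2 ^ L <_) (*-comm (2 ^ L) 2) (m<m*n (2 ^ L) 2 ⦃ m^n≢0 2 L ⦄ ≤-refl))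
              , *-monoʳ-≤ 2 (≤-trans (≤-reflexive (sym n≡)) (≤-trans (n≤1+n n) (n≤1+n (suc n))))

codeLength : ℕ → ℕ
codeLength n = proj₁ (log n)

-- The binary expansion: `finToFun` reads an element of `Fin (2 ^ L)` as its L digits.
digits : ∀ {n} → Fin n → Fin (codeLength n) → Fin 2
digits {n} v = finToFun (inject≤ v (proj₁ (proj₂ (log n))))

digits-injective : ∀ {n} {v w : Fin n} → digits v ≗ digits w → v ≡ w
digits-injective {n} {v} {w} eq = inject≤-injective n≤2^L n≤2^L v w (begin
  inject≤ v _           ≡⟨ sym (funToFin-finToFin {codeLength n} _) ⟩
  funToFin (digits v)   ≡⟨ funToFin-cong eq ⟩
  funToFin (digits w)   ≡⟨ funToFin-finToFin {codeLength n} _ ⟩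
  inject≤ w _           ∎)
  where
  open ≡-Reasoning
  n≤2^L = proj₁ (proj₂ (log n))
  funToFin-cong : ∀ {l m} {f g : Fin l → Fin m} → f ≗ g → funToFin f ≡ funToFin g
  funToFin-cong {zero}  f≗g = refl
  funToFin-cong {suc l} f≗g = cong₂ combine (f≗g zero) (funToFin-cong (f≗g ∘ suc))

code : ∀ {n} → Fin (codeLength n) → Fin n → Bool
code i v = does (digits v i Fin.≟ 0F)

code-separating : ∀ {n} → Separating (code {n})
code-separating {n} {v} {w} v≢w
  with i , ne ← ¬∀⟶∃¬ (codeLength n) (λ i → digits v i ≡ digits w i) (λ i → digits v i Fin.≟ digits w i) (v≢w ∘ digits-injective)
  = i , ne ∘ ≟0-injective _ _
  where
  ≟0-injective : ∀ (x y : Fin 2) → does (x Fin.≟ 0F) ≡ does (y Fin.≟ 0F) → x ≡ y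
  ≟0-injective 0F 0F _ = refl
  ≟0-injective 1F 1F _ = refl

-- Computable functions and size bounds

zeroRec : ∀ {n} → Rec n
zeroRec = comp zer []

zeroRec-⇓ : ∀ {n} {xs : Vec ℕ n} → zeroRec [ xs ]⇓ 0
zeroRec-⇓ = comp [] zer

addRec mulRec expRec : Rec 2
addRec = prim (proj 0F) (comp succ (proj 1F ∷ []))
mulRec = prim zeroRec (comp addRec (proj 2F ∷ proj 1F ∷ []))
-- The exponent comes first, being the recursion argument.
expRec = prim (comp succ (zeroRec ∷ [])) (comp mulRec (proj 2F ∷ proj 1F ∷ []))

addRec-⇓ : ∀ m n → addRec [ m ∷ n ∷ [] ]⇓ m + n
addRec-⇓ zero    n = prim₀ (proj 0F)
addRec-⇓ (suc m) n = primₛ (addRec-⇓ m n) (comp (proj 1F ∷ []) succ)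

mulRec-⇓ : ∀ m n → mulRec [ m ∷ n ∷ [] ]⇓ m * n
mulRec-⇓ zero    n = prim₀ zeroRec-⇓
mulRec-⇓ (suc m) n = primₛ (mulRec-⇓ m n) (comp (proj 2F ∷ proj 1F ∷ []) (addRec-⇓ n (m * n)))

expRec-⇓ : ∀ m n → expRec [ m ∷ n ∷ [] ]⇓ n ^ m
expRec-⇓ zero    n = prim₀ (comp (zeroRec-⇓ ∷ []) succ)
expRec-⇓ (suc m) n = primₛ (expRec-⇓ m n) (comp (proj 2F ∷ proj 1F ∷ []) (mulRec-⇓ n (n ^ m)))

computable-id : Computable (λ k → k)
computable-id = proj 0F , λ k → proj 0F

computable-const : ∀ c → Computable (λ _ → c)
computable-const zero    = zeroRec , λ _ → zeroRec-⇓
computable-const (suc c) with g , g⇓ ← computable-const c = comp succ (g ∷ []) , λ k → comp (g⇓ k ∷ []) succ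

module _ {f g : ℕ → ℕ} where

  computable-+ : Computable f → Computable g → Computable (λ k → f k + g k)
  computable-+ (f̂ , f⇓) (ĝ , g⇓) =
    comp addRec (f̂ ∷ ĝ ∷ []) , λ k → comp (f⇓ k ∷ g⇓ k ∷ []) (addRec-⇓ (f k) (g k))

  computable-* : Computable f → Computable g → Computable (λ k → f k * g k)
  computable-* (f̂ , f⇓) (ĝ , g⇓) =
    comp mulRec (f̂ ∷ ĝ ∷ []) , λ k → comp (f⇓ k ∷ g⇓ k ∷ []) (mulRec-⇓ (f k) (g k))

  computable-^ : Computable f → Computable g → Computable (λ k → f k ^ g k)
  computable-^ (f̂ , f⇓) (ĝ , g⇓) =
    comp expRec (ĝ ∷ f̂ ∷ []) , λ k → comp (g⇓ k ∷ f⇓ k ∷ []) (expRec-⇓ (g k) (f k))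

-- The size condition of `para-AC⁰` as a property of size functions, so that bounds compose along
-- the construction of a circuit without naming exponents or factors.
Tractable : (ℕ → ℕ → ℕ) → Set
Tractable s = Σ[ c ∈ ℕ ] Σ[ f ∈ (ℕ → ℕ) ] Computable f × (∀ n k → s n k ≤ f k * suc n ^ c)

tractable-param : ∀ {f} → Computable f → Tractable (λ _ k → f k)
tractable-param {f} cf = 0 , f , cf , λ n k → ≤-reflexive (sym (*-identityʳ (f k)))

tractable-const : ∀ c → Tractable (λ _ _ → c)
tractable-const c = tractable-param (computable-const c)

tractable-size : Tractable (λ n _ → n)
tractable-size = 1 , (λ _ → 1) , computable-const 1 , λ n k → begin
  n               ≤⟨ n≤1+n n ⟩
  suc n           ≡⟨ sym (trans (*-identityˡ _) (*-identityʳ (suc n))) ⟩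
  1 * suc n ^ 1   ∎
  where open ≤-Reasoning

tractable-≤ : ∀ {s t} → (∀ n k → s n k ≤ t n k) → Tractable t → Tractable s
tractable-≤ s≤t (c , f , cf , t≤) = c , f , cf , λ n k → ≤-trans (s≤t n k) (t≤ n k)

module _ {s t : ℕ → ℕ → ℕ} where
  open ≤-Reasoning

  tractable-+ : Tractable s → Tractable t → Tractable (λ n k → s n k + t n k)
  tractable-+ (c , f , cf , s≤) (d , g , cg , t≤) = c + d , _ , computable-+ cf cg , λ n k → begin
    s n k + t n k
      ≤⟨ +-mono-≤ (≤-trans (s≤ n k) (*-monoʳ-≤ (f k) (^-monoʳ-≤ (suc n) (m≤m+n c d))))
                  (≤-trans (t≤ n k) (*-monoʳ-≤ (g k) (^-monoʳ-≤ (suc n) (m≤n+m d c)))) ⟩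
    f k * suc n ^ (c + d) + g k * suc n ^ (c + d)
      ≡⟨ sym (*-distribʳ-+ (suc n ^ (c + d)) (f k) (g k)) ⟩
    (f k + g k) * suc n ^ (c + d) ∎

  tractable-* : Tractable s → Tractable t → Tractable (λ n k → s n k * t n k)
  tractable-* (c , f , cf , s≤) (d , g , cg , t≤) = c + d , _ , computable-* cf cg , λ n k → begin
    s n k * t n k                             ≤⟨ *-mono-≤ (s≤ n k) (t≤ n k) ⟩
    (f k * suc n ^ c) * (g k * suc n ^ d)     ≡⟨ [m*n]*[o*p]≡[m*o]*[n*p] (f k) (suc n ^ c) (g k) (suc n ^ d) ⟩
    (f k * g k) * (suc n ^ c * suc n ^ d)     ≡⟨ cong (f k * g k *_) (sym (^-distribˡ-+-* (suc n) c d)) ⟩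
    (f k * g k) * suc n ^ (c + d)             ∎

tractable-suc : ∀ {s} → Tractable s → Tractable (λ n k → suc (s n k))
tractable-suc = tractable-+ (tractable-const 1)

-- A telescoping bound: the increments of x ^ suc j are at most suc j * suc x ^ j,
-- and the powers of two sum up to a power of two.
^≤2^ : ∀ j x → x ^ j ≤ (2 * j) ^ j * 2 ^ x
^≤2^ zero    x       = ≤-trans (m^n>0 2 x) (≤-reflexive (sym (*-identityˡ _)))
^≤2^ (suc j) zero    = z≤n
^≤2^ (suc j) (suc x) = begin
  suc x ^ suc j
    ≤⟨ increment j ⟩
  x ^ suc j + suc j * suc x ^ j
    ≤⟨ +-mono-≤ (^≤2^ (suc j) x) (*-monoʳ-≤ (suc j) (≤-trans (^≤2^ j (suc x)) (*-monoˡ-≤ (2 ^ suc x) (^-monoˡ-≤ j (*-monoʳ-≤ 2 (n≤1+n j)))))) ⟩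
  (2 * suc j) ^ suc j * 2 ^ x + suc j * ((2 * suc j) ^ j * 2 ^ suc x)
    ≡⟨ cong ((2 * suc j) ^ suc j * 2 ^ x +_) (rearrange (suc j) ((2 * suc j) ^ j) (2 ^ x)) ⟩
  (2 * suc j) ^ suc j * 2 ^ x + (2 * suc j) ^ suc j * 2 ^ x
    ≡⟨ double ((2 * suc j) ^ suc j) (2 ^ x) ⟩
  (2 * suc j) ^ suc j * 2 ^ suc x ∎
  where
  open ≤-Reasoning
  rearrange : ∀ a b c → a * (b * (2 * c)) ≡ (2 * a) * b * c
  rearrange = solve-∀
  double : ∀ a b → a * b + a * b ≡ a * (2 * b)
  double = solve-∀
  increment : ∀ j → suc x ^ suc j ≤ x ^ suc j + suc j * suc x ^ j
  increment zero    = ≤-reflexive (base x)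
    where
    base : ∀ x → suc x * 1 ≡ x * 1 + (1 + 0)
    base = solve-∀
  increment (suc j) = begin
    suc x * suc x ^ suc j
      ≡⟨ +-comm (suc x ^ suc j) _ ⟩
    x * suc x ^ suc j + suc x ^ suc j
      ≤⟨ +-monoˡ-≤ _ (*-monoʳ-≤ x (increment j)) ⟩
    x * (x ^ suc j + suc j * suc x ^ j) + suc x ^ suc j
      ≡⟨ cong (_+ suc x ^ suc j) (*-distribˡ-+ x (x ^ suc j) _) ⟩
    x ^ suc (suc j) + x * (suc j * suc x ^ j) + suc x ^ suc j
      ≤⟨ +-monoˡ-≤ (suc x ^ suc j) (+-monoʳ-≤ (x ^ suc (suc j)) (*-monoˡ-≤ (suc j * suc x ^ j) (n≤1+n x))) ⟩
    x ^ suc (suc j) + suc x * (suc j * suc x ^ j) + suc x ^ suc j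
      ≡⟨ collect (x ^ suc (suc j)) (suc x) (suc j) (suc x ^ j) ⟩
    x ^ suc (suc j) + suc (suc j) * suc x ^ suc j ∎
    where
    collect : ∀ c y i b → c + y * (i * b) + y * b ≡ c + (y * b + i * (y * b))
    collect = solve-∀

-- The exponent depends on the parameter and must not end up on n. `^≤2^` at 2 + `codeLength n`
-- moves it into the factor (2j)^j and leaves 4 times 2 ^ `codeLength n`, which is at most 8 (n +
-- 1).
tractable-logPower : ∀ {j} → Computable j → Tractable (λ n k → (2 + codeLength n) ^ j k)
tractable-logPower {j} cj =
  tractable-≤ bound
    (tractable-* (tractable-param (computable-^ (computable-* (computable-const 2) cj) cj))
      (tractable-* (tractable-const 8) (tractable-+ (tractable-const 1) tractable-size)))
  where
  open ≤-Reasoning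
  bound : ∀ n k → (2 + codeLength n) ^ j k ≤ (2 * j k) ^ j k * (8 * suc n)
  bound n k = begin
    (2 + codeLength n) ^ j k                      ≤⟨ ^≤2^ (j k) (2 + codeLength n) ⟩
    (2 * j k) ^ j k * 2 ^ (2 + codeLength n)      ≤⟨ *-monoʳ-≤ ((2 * j k) ^ j k) (begin
      2 * (2 * 2 ^ codeLength n)                    ≤⟨ *-monoʳ-≤ 2 (*-monoʳ-≤ 2 (proj₂ (proj₂ (log n)))) ⟩
      2 * (2 * (2 * suc n))                         ≡⟨ eight (suc n) ⟩
      8 * suc n                                     ∎) ⟩
    (2 * j k) ^ j k * (8 * suc n)                 ∎
    where
    eight : ∀ m → 2 * (2 * (2 * m)) ≡ 8 * m
    eight = solve-∀

-- Circuits

value : ∀ {N m} → Gates N m → (Fin N → Bool) → Wire N m → Bool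
value gs x = wire-value x (gate-values x gs)

height : ∀ {N m} → Gates N m → Wire N m → ℕ
height gs = wire-depth (gate-depths gs)

maxDepth : ∀ {N m} → Gates N m → ℕ
maxDepth gs = Vec.foldr′ _⊔_ 0 (gate-depths gs)

-- Gates are numbered from the top, so each added gate renumbers the wires below it; `lift` is this
-- renumbering.
record Extension {N m} (gs : Gates N m) (m′ : ℕ) : Set where
  field
    gates       : Gates N m′
    lift        : Wire N m → Wire N m′
    lift-value  : ∀ x w → value gates x (lift w) ≡ value gs x w
    lift-height : ∀ w → height gates (lift w) ≡ height gs w

open Extension

infixr 5 _◅_
_◅_ : ∀ {N m} (g : Gate N m) (gs : Gates N m) → Extension gs (suc m)
(g ◅ gs) .gates = g ∷ gs
(g ◅ gs) .lift (input i) = input i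
(g ◅ gs) .lift (gate j)  = gate (suc j)
(g ◅ gs) .lift-value x (input i) = refl
(g ◅ gs) .lift-value x (gate j)  = refl
(g ◅ gs) .lift-height (input i) = refl
(g ◅ gs) .lift-height (gate j)  = refl

idₑ : ∀ {N m} (gs : Gates N m) → Extension gs m
idₑ gs .gates = gs
idₑ gs .lift = id
idₑ gs .lift-value x w = refl
idₑ gs .lift-height w = refl

infixl 5 _▻_
_▻_ : ∀ {N m m′ m″} {gs : Gates N m} (ex : Extension gs m′) → Extension (gates ex) m″ → Extension gs m″
(ex ▻ ex′) .gates = gates ex′
(ex ▻ ex′) .lift = lift ex′ ∘ lift ex
(ex ▻ ex′) .lift-value x w = trans (lift-value ex′ x (lift ex w)) (lift-value ex x w)
(ex ▻ ex′) .lift-height w = trans (lift-height ex′ (lift ex w)) (lift-height ex w)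

-- Two depth bounds are kept: `height≤` is what gates placed on `out` build upon, while `maxDepth≤`
-- covers every gate, as `depth` demands.
record Built {N m} (gs : Gates N m) (d s : ℕ) (f : (Fin N → Bool) → Bool) : Set where
  field
    {total}    : ℕ
    extension  : Extension gs total
    out        : Wire N total
    total≤     : total ≤ s + m
    height≤    : height (gates extension) out ≤ d
    maxDepth≤  : maxDepth (gates extension) ≤ maxDepth gs ⊔ d
    value-out  : ∀ x → value (gates extension) x out ≡ f x

-- A function is computed in depth d and size s if s gates of depth at most d
-- can be put on top of any circuit so that the function appears on a wire.
Computes : ∀ {N} → ℕ → ℕ → ((Fin N → Bool) → Bool) → Set
Computes {N} d s f = ∀ {m} (gs : Gates N m) → Built gs d s f

module _ {N : ℕ} where

  computes-mono : ∀ {d d′ s s′ f} → d ≤ d′ → s ≤ s′ → Computes {N} d s f → Computes d′ s′ f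
  computes-mono d≤ s≤ C {m} gs = record
    { extension = extension
    ; out       = out
    ; total≤    = ≤-trans total≤ (+-monoˡ-≤ m s≤)
    ; height≤   = ≤-trans height≤ d≤
    ; maxDepth≤ = ≤-trans maxDepth≤ (⊔-monoʳ-≤ (maxDepth gs) d≤)
    ; value-out = value-out
    } where open Built (C gs)

  computes-≗ : ∀ {d s f g} → f ≗ g → Computes {N} d s f → Computes d s g
  computes-≗ f≗g C gs = record
    { extension = extension
    ; out       = out
    ; total≤    = total≤
    ; height≤   = height≤
    ; maxDepth≤ = maxDepth≤
    ; value-out = λ x → trans (value-out x) (f≗g x)
    } where open Built (C gs)

  computes-input : ∀ i → Computes {N} 0 0 (λ x → x i)
  computes-input i gs = record
    { extension = idₑ gs
    ; out       = input i
    ; total≤    = ≤-refl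
    ; height≤   = z≤n
    ; maxDepth≤ = m≤m⊔n (maxDepth gs) 0
    ; value-out = λ x → refl
    }

  computes-not : ∀ {d s f} → Computes {N} d s f → Computes (suc d) (suc s) (not ∘ f)
  computes-not {d} C gs = record
    { extension = extension ▻ (NOT out ◅ gates extension)
    ; out       = gate zero
    ; total≤    = s≤s total≤
    ; height≤   = s≤s height≤
    ; maxDepth≤ = ⊔-lub (≤-trans (s≤s height≤) (m≤n⊔m (maxDepth gs) (suc d)))
                        (≤-trans maxDepth≤ (⊔-monoʳ-≤ (maxDepth gs) (n≤1+n d)))
    ; value-out = cong not ∘ value-out
    } where open Built (C gs)

  max≤ : ∀ {m d} {h : Wire N m → ℕ} {ws} → All (λ w → h w ≤ d) ws → suc (max 0 (map h ws)) ≤ suc d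
  max≤ hs = max<v⁺ (s≤s z≤n) (All.map⁺ (All.map s≤s hs))

  module _ {Y : Set} {d s : ℕ} {F : Y → (Fin N → Bool) → Bool} where

    record BuiltAll {m} (gs : Gates N m) (ys : List Y) : Set where
      field
        {total}     : ℕ
        extension   : Extension gs total
        outs        : List (Wire N total)
        total≤      : total ≤ length ys * s + m
        heights≤    : All (λ w → height (gates extension) w ≤ d) outs
        maxDepth≤   : maxDepth (gates extension) ≤ maxDepth gs ⊔ d
        values-outs : ∀ x → map (value (gates extension) x) outs ≡ map (λ y → F y x) ys

    -- All functions go into one gate list, each on top of the previous ones. Sizes add up but
    -- depths do not, because the height of an output is bounded independently of the gates it was
    -- put on. The premise is restricted to members of `ys`, since some size bounds hold only for
    -- those.
    buildAll : ∀ {m} (gs : Gates N m) ys → (∀ {y} → y ∈ ys → Computes d s (F y)) → BuiltAll gs ys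
    buildAll gs [] C = record
      { extension   = idₑ gs
      ; outs        = []
      ; total≤      = ≤-refl
      ; heights≤    = []
      ; maxDepth≤   = m≤m⊔n (maxDepth gs) d
      ; values-outs = λ x → refl
      }
    buildAll {m} gs (y ∷ ys) C = record
      { extension   = ex ▻ B.extension
      ; outs        = lift B.extension out ∷ B.outs
      ; total≤      = begin
          B.total                        ≤⟨ B.total≤ ⟩
          length ys * s + total          ≤⟨ +-monoʳ-≤ (length ys * s) total≤ ⟩
          length ys * s + (s + m)        ≡⟨ sym (+-assoc (length ys * s) s m) ⟩
          length ys * s + s + m          ≡⟨ cong (_+ m) (+-comm (length ys * s) s) ⟩
          s + length ys * s + m          ∎
      ; heights≤    = ≤-trans (≤-reflexive (lift-height B.extension out)) height≤ ∷ B.heights≤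
      ; maxDepth≤   = begin
          maxDepth (gates B.extension)   ≤⟨ B.maxDepth≤ ⟩
          maxDepth (gates ex) ⊔ d        ≤⟨ ⊔-monoˡ-≤ d maxDepth≤ ⟩
          maxDepth gs ⊔ d ⊔ d            ≡⟨ ⊔-assoc (maxDepth gs) d d ⟩
          maxDepth gs ⊔ (d ⊔ d)          ≡⟨ cong (maxDepth gs ⊔_) (⊔-idem d) ⟩
          maxDepth gs ⊔ d                ∎
      ; values-outs = λ x → cong₂ _∷_ (trans (lift-value B.extension x out) (value-out x)) (B.values-outs x)
      }
      where
      open ≤-Reasoning
      open Built (C (here refl) gs) renaming (extension to ex)
      module B = BuiltAll (buildAll (gates ex) ys (C ∘ there))

    computes-all : ∀ ys → (∀ {y} → y ∈ ys → Computes d s (F y)) →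
                   Computes (suc d) (suc (length ys * s)) (λ x → all (λ y → F y x) ys)
    computes-all ys C gs = record
      { extension = extension ▻ (AND outs ◅ gates extension)
      ; out       = gate zero
      ; total≤    = s≤s total≤
      ; height≤   = max≤ heights≤
      ; maxDepth≤ = ⊔-lub (≤-trans (max≤ heights≤) (m≤n⊔m (maxDepth gs) (suc d)))
                          (≤-trans maxDepth≤ (⊔-monoʳ-≤ (maxDepth gs) (n≤1+n d)))
      ; value-out = cong and ∘ values-outs
      } where open BuiltAll (buildAll gs ys C)

    computes-any : ∀ ys → (∀ {y} → y ∈ ys → Computes d s (F y)) →
                   Computes (suc d) (suc (length ys * s)) (λ x → any (λ y → F y x) ys)
    computes-any ys C gs = record
      { extension = extension ▻ (OR outs ◅ gates extension)
      ; out       = gate zero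
      ; total≤    = s≤s total≤
      ; height≤   = max≤ heights≤
      ; maxDepth≤ = ⊔-lub (≤-trans (max≤ heights≤) (m≤n⊔m (maxDepth gs) (suc d)))
                          (≤-trans maxDepth≤ (⊔-monoʳ-≤ (maxDepth gs) (n≤1+n d)))
      ; value-out = cong or ∘ values-outs
      } where open BuiltAll (buildAll gs ys C)

-- Modulators as sequences of single changes

lookup-ext : ∀ {A : Set} {n} {xs ys : Vec A n} → lookup xs ≗ lookup ys → xs ≡ ys
lookup-ext {xs = xs} {ys} eq = trans (sym (tabulate∘lookup xs)) (trans (tabulate-cong eq) (tabulate∘lookup ys))

Colour : ℕ → Set
Colour = Vec Bool

infix 4 _≟ᶜ_
_≟ᶜ_ : ∀ {r} (σ τ : Colour r) → Dec (σ ≡ τ)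
_≟ᶜ_ = ≡-dec Bool._≟_

module _ {r n : ℕ} where

  bit : Structure r n → Fin r → Fin n → Bool
  bit A i v = lookup (lookup A i) v

  colour : Structure r n → Fin n → Colour r
  colour A v = Vec.map (λ R → lookup R v) A

  lookup-colour : ∀ A i v → lookup (colour A v) i ≡ bit A i v
  lookup-colour A i v = lookup-map i (λ R → lookup R v) A

  bit-ext : ∀ {A B : Structure r n} → (∀ i v → bit A i v ≡ bit B i v) → A ≡ B
  bit-ext eq = lookup-ext λ i → lookup-ext (eq i)

  toggle : Fin r → Fin n → Structure r n → Structure r n
  toggle i v A = updateAt A i (λ R → updateAt R v not)

  bit-toggle : ∀ i v A → bit (toggle i v A) i v ≡ not (bit A i v)
  bit-toggle i v A rewrite lookup∘updateAt i {λ R → updateAt R v not} A = lookup∘updateAt v (lookup A i)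

  bit-toggle-≢ : ∀ {i v j w} A → i ≢ j ⊎ v ≢ w → bit (toggle i v A) j w ≡ bit A j w
  bit-toggle-≢ {i} {v} {j} {w} A ne with i Fin.≟ j | ne
  ... | no i≢j   | _ rewrite lookup∘updateAt′ j i {λ R → updateAt R v not} (i≢j ∘ sym) A = refl
  ... | yes refl | inj₁ i≢j = contradiction refl i≢j
  ... | yes refl | inj₂ v≢w rewrite lookup∘updateAt i {λ R → updateAt R v not} A =
    lookup∘updateAt′ w v (v≢w ∘ sym) (lookup A i)

  colour-toggle : ∀ i v A → colour (toggle i v A) v ≡ updateAt (colour A v) i not
  colour-toggle i v A = lookup-ext λ j → trans (lookup-colour (toggle i v A) j v) (at j)
    where
    at : ∀ j → bit (toggle i v A) j v ≡ lookup (updateAt (colour A v) i not) j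
    at j with i Fin.≟ j
    ... | yes refl = trans (bit-toggle i v A)
                       (sym (trans (lookup∘updateAt i (colour A v)) (cong not (lookup-colour A i v))))
    ... | no i≢j   = trans (bit-toggle-≢ A (inj₁ i≢j))
                       (sym (trans (lookup∘updateAt′ j i (i≢j ∘ sym) (colour A v)) (lookup-colour A j v)))

  colour-toggle-≢ : ∀ {i v w} A → v ≢ w → colour (toggle i v A) w ≡ colour A w
  colour-toggle-≢ {i} {v} {w} A v≢w = lookup-ext λ j →
    trans (lookup-colour (toggle i v A) j w) (trans (bit-toggle-≢ A (inj₂ v≢w)) (sym (lookup-colour A j w)))

  bit-▷ : ∀ (A : Structure r n) (S : Modulator r n) i v → bit (A ▷ S) i v ≡ bit A i v xor bit S i v
  bit-▷ A S i v rewrite lookup-zipWith _△_ i A S = lookup-zipWith _xor_ v (lookup A i) (lookup S i)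

  -- Moving one change between structure and modulator: the two flips cancel in the symmetric
  -- difference.
  toggle-▷-toggle : ∀ i v A S → toggle i v A ▷ toggle i v S ≡ A ▷ S
  toggle-▷-toggle i v A S = bit-ext λ j w →
    trans (bit-▷ (toggle i v A) (toggle i v S) j w) (trans (at j w) (sym (bit-▷ A S j w)))
    where
    at : ∀ j w → bit (toggle i v A) j w xor bit (toggle i v S) j w ≡ bit A j w xor bit S j w
    at j w with i Fin.≟ j | v Fin.≟ w
    ... | yes refl | yes refl rewrite bit-toggle i v A | bit-toggle i v S with bit A i v | bit S i v
    ...   | true  | true  = refl
    ...   | true  | false = refl
    ...   | false | true  = refl
    ...   | false | false = refl
    at j w | no i≢j | _     = cong₂ _xor_ (bit-toggle-≢ A (inj₁ i≢j)) (bit-toggle-≢ S (inj₁ i≢j))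
    at j w | yes _ | no v≢w = cong₂ _xor_ (bit-toggle-≢ A (inj₂ v≢w)) (bit-toggle-≢ S (inj₂ v≢w))

  toggle-involutive : ∀ i v A → toggle i v (toggle i v A) ≡ A
  toggle-involutive i v A = bit-ext at
    where
    at : ∀ j w → bit (toggle i v (toggle i v A)) j w ≡ bit A j w
    at j w with i Fin.≟ j | v Fin.≟ w
    ... | yes refl | yes refl = trans (bit-toggle i v (toggle i v A))
                                  (trans (cong not (bit-toggle i v A)) (Bool.not-involutive _))
    ... | no i≢j | _     = trans (bit-toggle-≢ (toggle i v A) (inj₁ i≢j)) (bit-toggle-≢ A (inj₁ i≢j))
    ... | yes _ | no v≢w = trans (bit-toggle-≢ (toggle i v A) (inj₂ v≢w)) (bit-toggle-≢ A (inj₂ v≢w))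

∣toggle∣≤ : ∀ {n} (p : Subset n) v → ∣ updateAt p v not ∣ ≤ suc ∣ p ∣
∣toggle∣≤ (true  ∷ p) zero    = ≤-trans (n≤1+n _) (n≤1+n _)
∣toggle∣≤ (false ∷ p) zero    = ≤-refl
∣toggle∣≤ (true  ∷ p) (suc v) = s≤s (∣toggle∣≤ p v)
∣toggle∣≤ (false ∷ p) (suc v) = ∣toggle∣≤ p v

∥toggle∥≤ : ∀ {r n} i v (S : Modulator r n) → ∥ toggle i v S ∥ ≤ suc ∥ S ∥
∥toggle∥≤ zero    v (R ∷ S) = +-monoˡ-≤ ∥ S ∥ (∣toggle∣≤ R v)
∥toggle∥≤ (suc i) v (R ∷ S) = ≤-trans (+-monoʳ-≤ ∣ R ∣ (∥toggle∥≤ i v S)) (≤-reflexive (+-suc ∣ R ∣ ∥ S ∥))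

∣toggle∣< : ∀ {n} (p : Subset n) v → lookup p v ≡ true → suc ∣ updateAt p v not ∣ ≤ ∣ p ∣
∣toggle∣< (true  ∷ p) zero    eq = ≤-refl
∣toggle∣< (true  ∷ p) (suc v) eq = s≤s (∣toggle∣< p v eq)
∣toggle∣< (false ∷ p) (suc v) eq = ∣toggle∣< p v eq

∥toggle∥< : ∀ {r n} i v (S : Modulator r n) → bit S i v ≡ true → suc ∥ toggle i v S ∥ ≤ ∥ S ∥
∥toggle∥< zero    v (R ∷ S) eq = +-monoˡ-≤ ∥ S ∥ (∣toggle∣< R v eq)
∥toggle∥< (suc i) v (R ∷ S) eq =
  ≤-trans (≤-reflexive (sym (+-suc ∣ R ∣ _))) (+-monoʳ-≤ ∣ R ∣ (∥toggle∥< i v S eq))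

∥∅∥ : ∀ r n → ∥ Vec.replicate r (Vec.replicate n false) ∥ ≡ 0
∥∅∥ zero    n = refl
∥∅∥ (suc r) n = cong₂ _+_ (∣∅∣ n) (∥∅∥ r n)
  where
  ∣∅∣ : ∀ n → ∣ Vec.replicate n false ∣ ≡ 0
  ∣∅∣ zero    = refl
  ∣∅∣ (suc n) = ∣∅∣ n

-- The mode as a local test on the bit about to be flipped. It depends only on the colour of the
-- element, hence survives the passage to a similar structure.
Permitted : Mode → Bool → Set
Permitted del  b = b ≡ true
Permitted add  b = b ≡ false
Permitted edit b = ⊤

permitted? : ∀ ⊗ b → Dec (Permitted ⊗ b)
permitted? del  b = b Bool.≟ true
permitted? add  b = b Bool.≟ false
permitted? edit b = yes tt

admissible⁻ : ∀ ⊗ {r n} {A : Structure r n} {S} → Admissible ⊗ A S →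
              ∀ {i v} → bit S i v ≡ true → Permitted ⊗ (bit A i v)
admissible⁻ del  {A = A} {S} adm {i} {v} Siv = []=⇒lookup (adm i (lookup⇒[]= v _ Siv))
admissible⁻ add  {A = A} {S} adm {i} {v} Siv with bit A i v in Aiv
... | false = refl
... | true  = contradiction (subst (λ R → R Vec.[ v ]= true) (adm i)
                (x∈p∩q⁺ (lookup⇒[]= v _ Siv , lookup⇒[]= v _ Aiv))) ∉⊥
admissible⁻ edit adm Siv = tt

admissible⁺ : ∀ ⊗ {r n} {A : Structure r n} {S} →
              (∀ {i v} → bit S i v ≡ true → Permitted ⊗ (bit A i v)) → Admissible ⊗ A S
admissible⁺ del  perm i v∈S = lookup⇒[]= _ _ (perm ([]=⇒lookup v∈S))
admissible⁺ add  {A = A} {S} perm i = Empty-unique λ (v , v∈) →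
  let v∈S , v∈A = x∈p∩q⁻ (lookup S i) (lookup A i) v∈
  in contradiction (trans (sym ([]=⇒lookup v∈A)) (perm ([]=⇒lookup v∈S))) λ ()
admissible⁺ edit perm = tt

module _ {r n : ℕ} (A : Structure r n) where

  satQF? : ∀ {m} ρ (ψ : QuantifierFree r m) → Dec (SatQF A ρ ψ)
  satQF? ρ (rel i x) = map′ (lookup⇒[]= _ _) []=⇒lookup (bit A i (lookup ρ x) Bool.≟ true)
  satQF? ρ (x ≈̇ y)   = lookup ρ x Fin.≟ lookup ρ y
  satQF? ρ ⊤̇         = yes tt
  satQF? ρ ⊥̇         = no id
  satQF? ρ (¬̇ ψ)     = ¬? (satQF? ρ ψ)
  satQF? ρ (ψ ∧̇ χ)   = satQF? ρ ψ ×-dec satQF? ρ χ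
  satQF? ρ (ψ ∨̇ χ)   = satQF? ρ ψ ⊎-dec satQF? ρ χ

  sat? : ∀ {m} ρ (φ : Prenex r m) → Dec (Sat A ρ φ)
  sat? ρ (matrix ψ) = satQF? ρ ψ
  sat? ρ (∀̇ φ)      = all? λ v → sat? (v ∷ ρ) φ
  sat? ρ (∃̇ φ)      = any? λ v → sat? (v ∷ ρ) φ

module _ {r : ℕ} (⊗ : Mode) (φ : Sentence r) where

  -- Permission is tested in the current structure, and a bit may be revisited if the mode allows
  -- it; a second flip merely undoes the first, so nothing new becomes reachable.
  Solvable : ∀ {n} → ℕ → Structure r n → Set
  Solvable zero    A = A ⊨ φ
  Solvable (suc k) A = A ⊨ φ ⊎ ∃₂ λ i v → Permitted ⊗ (bit A i v) × Solvable k (toggle i v A)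

  solvable? : ∀ {n} k (A : Structure r n) → Dec (Solvable k A)
  solvable? zero    A = sat? A [] φ
  solvable? (suc k) A = sat? A [] φ ⊎-dec
    any? λ i → any? λ v → permitted? ⊗ (bit A i v) ×-dec solvable? k (toggle i v A)

  Modifiable : ∀ {n} → ℕ → Structure r n → Set
  Modifiable {n} k A = Σ[ S ∈ Modulator r n ] Admissible ⊗ A S × ∥ S ∥ ≤ k × A ▷ S ⊨ φ

  sat⇒solvable : ∀ {n} k {A : Structure r n} → A ⊨ φ → Solvable k A
  sat⇒solvable zero    A⊨φ = A⊨φ
  sat⇒solvable (suc k) A⊨φ = inj₁ A⊨φ

  -- Plays the members of `S` one at a time: the played member leaves `S` and enters the structure,
  -- the final result stays the same, and the norm drops by one.
  modifiable⇒solvable : ∀ {n} k {A : Structure r n} → Modifiable k A → Solvable k A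
  modifiable⇒solvable k {A} (S , adm , S≤k , A▷S⊨φ) with any? (λ i → any? (λ v → bit S i v Bool.≟ true))
  ... | no none = sat⇒solvable k (subst (_⊨ φ) (bit-ext unchanged) A▷S⊨φ)
    where
    unchanged : ∀ i v → bit (A ▷ S) i v ≡ bit A i v
    unchanged i v = trans (bit-▷ A S i v) (trans
      (cong (bit A i v xor_) (Bool.¬-not λ Siv → none (i , v , Siv))) (Bool.xor-identityʳ (bit A i v)))
  modifiable⇒solvable zero {A} (S , adm , S≤k , A▷S⊨φ) | yes (i , v , Siv) =
    contradiction (≤-trans (∥toggle∥< i v S Siv) S≤k) λ ()
  modifiable⇒solvable (suc k) {A} (S , adm , S≤k , A▷S⊨φ) | yes (i , v , Siv) =
    inj₂ (i , v , admissible⁻ ⊗ adm Siv , modifiable⇒solvable k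
      ( toggle i v S
      , admissible⁺ ⊗ still
      , ≤-pred (≤-trans (∥toggle∥< i v S Siv) S≤k)
      , subst (_⊨ φ) (sym (toggle-▷-toggle i v A S)) A▷S⊨φ))
    where
    still : ∀ {j w} → bit (toggle i v S) j w ≡ true → Permitted ⊗ (bit (toggle i v A) j w)
    -- At the played bit the new modulator is empty; at all others neither structure nor modulator
    -- has changed.
    still {j} {w} eq with i Fin.≟ j | v Fin.≟ w
    ... | yes refl | yes refl = contradiction (trans (sym eq) (trans (bit-toggle i v S) (cong not Siv))) λ ()
    ... | no i≢j | _ =
      subst (Permitted ⊗) (sym (bit-toggle-≢ A (inj₁ i≢j))) (admissible⁻ ⊗ adm (trans (sym (bit-toggle-≢ S (inj₁ i≢j))) eq))
    ... | yes _ | no v≢w =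
      subst (Permitted ⊗) (sym (bit-toggle-≢ A (inj₂ v≢w))) (admissible⁻ ⊗ adm (trans (sym (bit-toggle-≢ S (inj₂ v≢w))) eq))

  sat⇒modifiable : ∀ {n} k {A : Structure r n} → A ⊨ φ → Modifiable k A
  sat⇒modifiable {n} k {A} A⊨φ =
    ∅̂ , admissible⁺ ⊗ (λ {i} {v} eq → contradiction (trans (sym (bit-∅ i v)) eq) λ ())
      , ≤-trans (≤-reflexive (∥∅∥ r n)) z≤n
      , subst (_⊨ φ) (bit-ext λ i v → sym (trans (bit-▷ A ∅̂ i v)
          (trans (cong (bit A i v xor_) (bit-∅ i v)) (Bool.xor-identityʳ (bit A i v))))) A⊨φ
    where
    ∅̂ = Vec.replicate r (Vec.replicate n false)
    bit-∅ : ∀ i v → bit ∅̂ i v ≡ false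
    bit-∅ i v rewrite lookup-replicate i (Vec.replicate n false) = lookup-replicate v false

  -- The first move is toggled in `S`, not inserted: if later moves return to the same bit, the
  -- changes cancel and the norm even shrinks. An upper bound on the norm is all that is claimed.
  solvable⇒modifiable : ∀ {n} k {A : Structure r n} → Solvable k A → Modifiable k A
  solvable⇒modifiable zero    A⊨φ        = sat⇒modifiable 0 A⊨φ
  solvable⇒modifiable (suc k) (inj₁ A⊨φ) = sat⇒modifiable (suc k) A⊨φ
  solvable⇒modifiable (suc k) {A} (inj₂ (i , v , perm , sol))
    with S , adm , S≤k , sat ← solvable⇒modifiable k sol
    = toggle i v S
    , admissible⁺ ⊗ also
    , ≤-trans (∥toggle∥≤ i v S) (s≤s S≤k)
    , subst (_⊨ φ) (trans (sym (toggle-▷-toggle i v (toggle i v A) S)) (cong (_▷ toggle i v S) (toggle-involutive i v A))) sat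
    where
    also : ∀ {j w} → bit (toggle i v S) j w ≡ true → Permitted ⊗ (bit A j w)
    also {j} {w} eq with i Fin.≟ j | v Fin.≟ w
    -- Whatever later moves did here, this bit of the original structure passed the test when it was
    -- played.
    ... | yes refl | yes refl = perm
    ... | no i≢j | _ =
      subst (Permitted ⊗) (bit-toggle-≢ A (inj₁ i≢j)) (admissible⁻ ⊗ adm (trans (sym (bit-toggle-≢ S (inj₁ i≢j))) eq))
    ... | yes _ | no v≢w =
      subst (Permitted ⊗) (bit-toggle-≢ A (inj₂ v≢w)) (admissible⁻ ⊗ adm (trans (sym (bit-toggle-≢ S (inj₂ v≢w))) eq))

-- Ehrenfeucht–Fraïssé games on monadic structures

infix 4 _≈[_]_
_≈[_]_ : ℕ → ℕ → ℕ → Set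
m ≈[ t ] n = m ⊓ t ≡ n ⊓ t

≈-weaken : ∀ {t u m n} → t ≤ u → m ≈[ u ] n → m ≈[ t ] n
≈-weaken {t} {u} {m} {n} t≤u m≈n = begin
  m ⊓ t         ≡⟨ cong (m ⊓_) (sym (m≥n⇒m⊓n≡n t≤u)) ⟩
  m ⊓ (u ⊓ t)   ≡⟨ sym (⊓-assoc m u t) ⟩
  m ⊓ u ⊓ t     ≡⟨ cong (_⊓ t) m≈n ⟩
  n ⊓ u ⊓ t     ≡⟨ ⊓-assoc n u t ⟩
  n ⊓ (u ⊓ t)   ≡⟨ cong (n ⊓_) (m≥n⇒m⊓n≡n t≤u) ⟩
  n ⊓ t         ∎
  where open ≡-Reasoning

≈-suc : ∀ {t m n} → m ≈[ t ] n → suc m ≈[ t ] suc n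
≈-suc {t} {m} {n} m≈n = ≈-weaken {m = suc m} {suc n} (n≤1+n t) (cong suc m≈n)

≈-positive : ∀ {t} m n → m ≈[ suc t ] n → 1 ≤ m → 1 ≤ n
≈-positive (suc m) (suc n) _ _ = s≤s z≤n

everywhere : ∀ {n} → Fin n → Bool
everywhere = const true

module _ {r : ℕ} where

  hasColour : ∀ {n} → Structure r n → (Fin n → Bool) → Colour r → Fin n → Bool
  hasColour A U τ v = U v ∧ does (colour A v ≟ᶜ τ)

  frequency : ∀ {n} → Structure r n → (Fin n → Bool) → Colour r → ℕ
  frequency A U τ = count (hasColour A U τ)

  frequency-∖ : ∀ {n} (A : Structure r n) U τ {v} → U v ≡ true →
                frequency A U τ ≡ 𝟙 (does (colour A v ≟ᶜ τ)) + frequency A (U ∖ v) τ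
  frequency-∖ A U τ {v} Uv = trans (count-∖ (hasColour A U τ) v)
    (cong₂ (λ b → 𝟙 (b ∧ does (colour A v ≟ᶜ τ)) +_) Uv
       (count-cong λ w → sym (Bool.∧-assoc (not (does (v Fin.≟ w))) (U w) _)))

  Similar : ∀ {m n} → ℕ → Structure r m → (Fin m → Bool) → Structure r n → (Fin n → Bool) → Set
  Similar t A U B W = ∀ τ → frequency A U τ ≈[ t ] frequency B W τ

  module _ {m n t : ℕ} {A : Structure r m} {U : Fin m → Bool} {B : Structure r n} {W : Fin n → Bool}
           (sim : Similar (suc t) A U B W) where

    partner : ∀ {v} → U v ≡ true → ∃[ w ] W w ≡ true × colour A v ≡ colour B w
    partner {v} Uv
      with w , eq ← count-pos⁻ (hasColour B W (colour A v)) (≈-positive _ _ (sim (colour A v))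
             (count-pos⁺ (hasColour A U (colour A v)) {v} (cong₂ _∧_ Uv (dec-true (colour A v ≟ᶜ colour A v) refl))))
      with W w in Ww | colour B w ≟ᶜ colour A v | eq
    ... | true  | yes same | _  = w , Ww , sym same
    ... | true  | no _     | ()
    ... | false | _        | ()

    -- For the common colour of v and w a summand 1 is cancelled on both sides, which lowers the
    -- threshold by one; for every other colour the frequencies are unchanged and the threshold is
    -- only weakened.
    similar-∖ : ∀ {v w} → U v ≡ true → W w ≡ true → colour A v ≡ colour B w → Similar t A (U ∖ v) B (W ∖ w)
    similar-∖ {v} {w} Uv Ww same τ = cancel (does (colour B w ≟ᶜ τ)) (begin
      (𝟙 (does (colour B w ≟ᶜ τ)) + frequency A (U ∖ v) τ) ⊓ suc t
        ≡⟨ cong (λ σ → (𝟙 (does (σ ≟ᶜ τ)) + frequency A (U ∖ v) τ) ⊓ suc t) (sym same) ⟩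
      (𝟙 (does (colour A v ≟ᶜ τ)) + frequency A (U ∖ v) τ) ⊓ suc t
        ≡⟨ cong (_⊓ suc t) (sym (frequency-∖ A U τ Uv)) ⟩
      frequency A U τ ⊓ suc t
        ≡⟨ sim τ ⟩
      frequency B W τ ⊓ suc t
        ≡⟨ cong (_⊓ suc t) (frequency-∖ B W τ Ww) ⟩
      (𝟙 (does (colour B w ≟ᶜ τ)) + frequency B (W ∖ w) τ) ⊓ suc t ∎)
      where
      open ≡-Reasoning
      cancel : ∀ b {m n} → 𝟙 b + m ≈[ suc t ] 𝟙 b + n → m ≈[ t ] n
      cancel true          eq = suc-injective eq
      cancel false {m} {n} eq = ≈-weaken {m = m} {n} (n≤1+n t) eq

  frequency-toggle : ∀ {n} i v (A : Structure r n) τ → frequency (toggle i v A) everywhere τ ≡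
    𝟙 (does (updateAt (colour A v) i not ≟ᶜ τ)) + frequency A (everywhere ∖ v) τ
  frequency-toggle i v A τ = trans (frequency-∖ (toggle i v A) everywhere τ refl)
    (cong₂ (λ σ → 𝟙 (does (σ ≟ᶜ τ)) +_) (colour-toggle i v A) (count-cong unaffected))
    where
    unaffected : hasColour (toggle i v A) (everywhere ∖ v) τ ≗ hasColour A (everywhere ∖ v) τ
    unaffected w with v Fin.≟ w
    ... | yes _  = refl
    ... | no v≢w = cong (λ σ → does (σ ≟ᶜ τ)) (colour-toggle-≢ A v≢w)

  -- A toggle removes an element of the old colour and adds one of the new colour. Only the removal
  -- costs a unit of threshold.
  similar-toggle : ∀ {m n t} {A : Structure r m} {B : Structure r n} i {v w} →
                   Similar (suc t) A everywhere B everywhere → colour A v ≡ colour B w →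
                   Similar t (toggle i v A) everywhere (toggle i w B) everywhere
  similar-toggle {t = t} {A} {B} i {v} {w} sim same τ = begin
    frequency (toggle i v A) everywhere τ ⊓ t
      ≡⟨ cong (_⊓ t) (frequency-toggle i v A τ) ⟩
    (𝟙 (does (updateAt (colour A v) i not ≟ᶜ τ)) + frequency A (everywhere ∖ v) τ) ⊓ t
      ≡⟨ cong (λ σ → (𝟙 (does (updateAt σ i not ≟ᶜ τ)) + frequency A (everywhere ∖ v) τ) ⊓ t) same ⟩
    (𝟙 (does (updateAt (colour B w) i not ≟ᶜ τ)) + frequency A (everywhere ∖ v) τ) ⊓ t
      ≡⟨ add𝟙 (does (updateAt (colour B w) i not ≟ᶜ τ)) (similar-∖ sim refl refl same τ) ⟩
    (𝟙 (does (updateAt (colour B w) i not ≟ᶜ τ)) + frequency B (everywhere ∖ w) τ) ⊓ t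
      ≡⟨ cong (_⊓ t) (sym (frequency-toggle i w B τ)) ⟩
    frequency (toggle i w B) everywhere τ ⊓ t ∎
    where
    open ≡-Reasoning
    add𝟙 : ∀ b {m n} → m ≈[ t ] n → 𝟙 b + m ≈[ t ] 𝟙 b + n
    add𝟙 true  {m} {n} eq = ≈-suc {m = m} {n} eq
    add𝟙 false eq = eq

  -- The Ehrenfeucht–Fraïssé invariant with t moves to go; U and W are the
  -- elements that no variable names.
  record Matching {m n l} (t : ℕ) (A : Structure r m) (ρ : Vec (Fin m) l) (U : Fin m → Bool)
                  (B : Structure r n) (ρ′ : Vec (Fin n) l) (W : Fin n → Bool) : Set where
    field
      similar : Similar t A U B W
      same    : ∀ x → colour A (lookup ρ x) ≡ colour B (lookup ρ′ x)
      coincide   : ∀ x y → lookup ρ x ≡ lookup ρ y ⇔ lookup ρ′ x ≡ lookup ρ′ y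
      namedˡ  : ∀ {v} → U v ≡ false → ∃[ x ] lookup ρ x ≡ v
      namedʳ  : ∀ {w} → W w ≡ false → ∃[ x ] lookup ρ′ x ≡ w
      usedˡ   : ∀ x → U (lookup ρ x) ≡ false
      usedʳ   : ∀ x → W (lookup ρ′ x) ≡ false

  matching-sym : ∀ {m n l t} {A : Structure r m} {ρ : Vec (Fin m) l} {U} {B : Structure r n} {ρ′ W} →
                 Matching t A ρ U B ρ′ W → Matching t B ρ′ W A ρ U
  matching-sym M = record
    { similar = sym ∘ similar
    ; same    = sym ∘ same
    ; coincide   = λ x y → mk⇔ (Equivalence.from (coincide x y)) (Equivalence.to (coincide x y))
    ; namedˡ  = namedʳ
    ; namedʳ  = namedˡ
    ; usedˡ   = usedʳ
    ; usedʳ   = usedˡ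
    } where open Matching M

  module _ {m n l t : ℕ} {A : Structure r m} {ρ : Vec (Fin m) l} {U : Fin m → Bool}
           {B : Structure r n} {ρ′ : Vec (Fin n) l} {W : Fin n → Bool} where

    matching-old : Matching (suc t) A ρ U B ρ′ W → ∀ x →
                   Matching t A (lookup ρ x ∷ ρ) U B (lookup ρ′ x ∷ ρ′) W
    matching-old M x = record
      { similar = λ τ → ≈-weaken {m = frequency A U τ} {frequency B W τ} (n≤1+n t) (similar τ)
      ; same    = λ where zero → same x; (suc y) → same y
      ; coincide   = λ where
          zero    zero    → mk⇔ (const refl) (const refl)
          zero    (suc z) → coincide x z
          (suc y) zero    → coincide y x
          (suc y) (suc z) → coincide y z
      ; namedˡ  = Product.map suc id ∘ namedˡ
      ; namedʳ  = Product.map suc id ∘ namedʳ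
      ; usedˡ   = λ where zero → usedˡ x; (suc y) → usedˡ y
      ; usedʳ   = λ where zero → usedʳ x; (suc y) → usedʳ y
      } where open Matching M

    matching-new : Matching (suc t) A ρ U B ρ′ W → ∀ {v w} → U v ≡ true → W w ≡ true → colour A v ≡ colour B w →
                   Matching t A (v ∷ ρ) (U ∖ v) B (w ∷ ρ′) (W ∖ w)
    matching-new M {v} {w} Uv Ww same-vw = record
      { similar = similar-∖ similar Uv Ww same-vw
      ; same    = λ where zero → same-vw; (suc x) → same x
      ; coincide   = λ where
          zero    zero    → mk⇔ (const refl) (const refl)
          zero    (suc y) → mk⇔ (λ eq → contradiction eq (distinctˡ y)) (λ eq → contradiction eq (distinctʳ y))
          (suc x) zero    → mk⇔ (λ eq → contradiction (sym eq) (distinctˡ x)) (λ eq → contradiction (sym eq) (distinctʳ x))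
          (suc x) (suc y) → coincide x y
      ; namedˡ  = named v namedˡ
      ; namedʳ  = named w namedʳ
      ; usedˡ   = λ where zero → ∖-removed U v; (suc x) → trans (∖-kept U (distinctˡ x)) (usedˡ x)
      ; usedʳ   = λ where zero → ∖-removed W w; (suc x) → trans (∖-kept W (distinctʳ x)) (usedʳ x)
      }
      where
      open Matching M
      distinctˡ : ∀ x → v ≢ lookup ρ x
      distinctˡ x v≡ = contradiction (trans (sym Uv) (trans (cong U v≡) (usedˡ x))) λ ()
      distinctʳ : ∀ x → w ≢ lookup ρ′ x
      distinctʳ x w≡ = contradiction (trans (sym Ww) (trans (cong W w≡) (usedʳ x))) λ ()
      named : ∀ {k} u {X : Fin k → Bool} {σ : Vec (Fin k) l} →
              (∀ {v} → X v ≡ false → ∃[ x ] lookup σ x ≡ v) →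
              ∀ {v} → (X ∖ u) v ≡ false → ∃[ x ] lookup (u ∷ σ) x ≡ v
      named u nm {v} eq with u Fin.≟ v
      ... | yes u≡v = zero , u≡v
      ... | no _    = Product.map suc id (nm eq)

    -- The reply strategy: an element already named by a variable is answered by the element of the
    -- same name, an unnamed one by an unnamed `partner` of its colour, which exists because the
    -- threshold is still positive.
    matching-step : Matching (suc t) A ρ U B ρ′ W → ∀ v →
                    ∃[ w ] ∃₂ λ U′ W′ → Matching t A (v ∷ ρ) U′ B (w ∷ ρ′) W′
    matching-step M v with U v in Uv
    ... | true with w , Ww , same-vw ← partner (Matching.similar M) Uv =
      w , _ , _ , matching-new M Uv Ww same-vw
    ... | false with x , refl ← Matching.namedˡ M Uv = _ , _ , _ , matching-old M x

  satQF-transfer : ∀ {m n l t} {A : Structure r m} {ρ : Vec (Fin m) l} {U} {B : Structure r n} {ρ′ W} →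
                   Matching t A ρ U B ρ′ W → ∀ ψ → SatQF A ρ ψ → SatQF B ρ′ ψ
  satQF-transfer {A = A} {ρ} {B = B} {ρ′} M (rel i x) sat = lookup⇒[]= _ _ (begin
    bit B i (lookup ρ′ x)               ≡⟨ sym (lookup-colour B i _) ⟩
    lookup (colour B (lookup ρ′ x)) i   ≡⟨ cong (λ τ → lookup τ i) (sym (Matching.same M x)) ⟩
    lookup (colour A (lookup ρ x)) i    ≡⟨ lookup-colour A i _ ⟩
    bit A i (lookup ρ x)                ≡⟨ []=⇒lookup sat ⟩
    true                                ∎)
    where open ≡-Reasoning
  satQF-transfer M (x ≈̇ y) sat = Equivalence.to (Matching.coincide M x y) sat
  satQF-transfer M ⊤̇       sat = tt
  satQF-transfer M (¬̇ ψ)   sat = sat ∘ satQF-transfer (matching-sym M) ψ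
  satQF-transfer M (ψ ∧̇ χ) (p , q)  = satQF-transfer M ψ p , satQF-transfer M χ q
  satQF-transfer M (ψ ∨̇ χ) (inj₁ p) = inj₁ (satQF-transfer M ψ p)
  satQF-transfer M (ψ ∨̇ χ) (inj₂ q) = inj₂ (satQF-transfer M χ q)

  sat-transfer : ∀ {m n l} {A : Structure r m} {ρ : Vec (Fin m) l} {U} {B : Structure r n} {ρ′ W} φ →
                 Matching (length (pattern-of φ)) A ρ U B ρ′ W → Sat A ρ φ → Sat B ρ′ φ
  sat-transfer (matrix ψ) M sat = satQF-transfer M ψ sat
  sat-transfer (∀̇ φ) M sat w
    -- The challenge is posed in the second structure, so the reply comes from the reversed game.
    with v , _ , _ , M′ ← matching-step (matching-sym M) w = sat-transfer φ (matching-sym M′) (sat v)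
  sat-transfer (∃̇ φ) M (v , sat)
    with w , _ , _ , M′ ← matching-step M v = w , sat-transfer φ M′ sat

  module _ (⊗ : Mode) (φ : Sentence r) where

    ⊨-transfer : ∀ {m n t} {A : Structure r m} {B : Structure r n} → length (pattern-of φ) ≤ t →
                 Similar t A everywhere B everywhere → A ⊨ φ → B ⊨ φ
    ⊨-transfer {A = A} {B} q≤t sim = sat-transfer φ record
      { similar = λ τ → ≈-weaken {m = frequency A everywhere τ} {frequency B everywhere τ} q≤t (sim τ)
      ; same    = λ ()
      ; coincide   = λ ()
      ; namedˡ  = λ ()
      ; namedʳ  = λ ()
      ; usedˡ   = λ ()
      ; usedʳ   = λ ()
      }

    -- Every toggle is answered at a partner of the same colour and spends one of the k units; the
    -- units that remain pay for the quantifiers of φ.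
    solvable-transfer : ∀ k {m n} {A : Structure r m} {B : Structure r n} →
                        Similar (k + length (pattern-of φ)) A everywhere B everywhere →
                        Solvable ⊗ φ k A → Solvable ⊗ φ k B
    solvable-transfer zero    sim A⊨φ        = ⊨-transfer ≤-refl sim A⊨φ
    solvable-transfer (suc k) sim (inj₁ A⊨φ) = inj₁ (⊨-transfer (m≤n+m _ (suc k)) sim A⊨φ)
    solvable-transfer (suc k) {A = A} {B} sim (inj₂ (i , v , perm , sol))
      with w , _ , same ← partner {A = A} {everywhere} {B} {everywhere} sim {v} refl
      = inj₂ (i , w , subst (Permitted ⊗) same-bit perm , solvable-transfer k (similar-toggle {A = A} {B} i {v} {w} sim same) sol)
      where
      same-bit : bit A i v ≡ bit B i w
      same-bit = trans (sym (lookup-colour A i v)) (trans (cong (λ τ → lookup τ i) same) (lookup-colour B i w))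

-- Representatives of similarity classes

does-true : ∀ {P : Set} (P? : Dec P) → does P? ≡ true → P
does-true (yes p) _ = p

bool-ext : ∀ {x y} → (x ≡ true → y ≡ true) → (y ≡ true → x ≡ true) → x ≡ y
bool-ext x⇒y y⇒x = Bool.⇔→≡ (mk⇔ x⇒y y⇒x)

∧-true⁻ : ∀ x {y} → x ∧ y ≡ true → x ≡ true × y ≡ true
∧-true⁻ true eq = refl , eq

module _ {Y : Set} {p : Y → Bool} where

  any-true⁺ : ∀ {y ys} → y ∈ ys → p y ≡ true → any p ys ≡ true
  any-true⁺ (here refl) py rewrite py = refl
  any-true⁺ {ys = z ∷ _} (there y∈) py with p z
  ... | true  = refl
  ... | false = any-true⁺ y∈ py

  any-true⁻ : ∀ ys → any p ys ≡ true → ∃[ y ] y ∈ ys × p y ≡ true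
  any-true⁻ (y ∷ ys) eq with p y in py
  ... | true  = y , here refl , py
  ... | false with z , z∈ , pz ← any-true⁻ ys eq = z , there z∈ , pz

  all-true⁺ : ∀ {ys} → All (λ y → p y ≡ true) ys → all p ys ≡ true
  all-true⁺ []         = refl
  all-true⁺ (py ∷ pys) = cong₂ _∧_ py (all-true⁺ pys)

  all-true⁻ : ∀ ys → all p ys ≡ true → All (λ y → p y ≡ true) ys
  all-true⁻ []       eq = []
  all-true⁻ (y ∷ ys) eq with p y in py
  ... | true = py ∷ all-true⁻ ys eq

module _ {r : ℕ} where

  occurrences : Colour r → List (Colour r) → ℕ
  occurrences σ τs = count (λ v → does (List.lookup τs v ≟ᶜ σ))

  occurrences-++ : ∀ σ xs ys → occurrences σ (xs ++ ys) ≡ occurrences σ xs + occurrences σ ys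
  occurrences-++ σ []       ys = refl
  occurrences-++ σ (x ∷ xs) ys =
    trans (cong (𝟙 (does (x ≟ᶜ σ)) +_) (occurrences-++ σ xs ys)) (sym (+-assoc (𝟙 (does (x ≟ᶜ σ))) _ _))

  occurrences-replicate : ∀ σ m → occurrences σ (replicate m σ) ≡ m
  occurrences-replicate σ zero = refl
  occurrences-replicate σ (suc m) rewrite dec-true (σ ≟ᶜ σ) refl = cong suc (occurrences-replicate σ m)

  occurrences-replicate-≢ : ∀ {σ τ} m → τ ≢ σ → occurrences σ (replicate m τ) ≡ 0
  occurrences-replicate-≢ zero τ≢σ = refl
  occurrences-replicate-≢ {σ} {τ} (suc m) τ≢σ rewrite dec-false (τ ≟ᶜ σ) τ≢σ = occurrences-replicate-≢ m τ≢σ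

  census : (Colour r → ℕ) → List (Colour r) → List (Colour r)
  census f = concatMap (λ τ → replicate (f τ) τ)

  occurrences-census-∉ : ∀ f {σ τs} → All (_≢ σ) τs → occurrences σ (census f τs) ≡ 0
  occurrences-census-∉ f [] = refl
  occurrences-census-∉ f {σ} {τ ∷ τs} (τ≢σ ∷ τs≢σ) =
    trans (occurrences-++ σ (replicate (f τ) τ) _)
          (cong₂ _+_ (occurrences-replicate-≢ (f τ) τ≢σ) (occurrences-census-∉ f τs≢σ))

  occurrences-census : ∀ f {σ τs} → Unique τs → σ ∈ τs → occurrences σ (census f τs) ≡ f σ
  occurrences-census f {σ} (σ≢ ∷ _) (here refl) =
    trans (occurrences-++ σ (replicate (f σ) σ) _)
      (trans (cong₂ _+_ (occurrences-replicate σ (f σ)) (occurrences-census-∉ f (All.map (λ ne → ne ∘ sym) σ≢)))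
             (+-identityʳ (f σ)))
  occurrences-census f {σ} {τ ∷ τs} (τ≢ ∷ unique) (there σ∈) =
    trans (occurrences-++ σ (replicate (f τ) τ) _)
          (cong₂ _+_ (occurrences-replicate-≢ (f τ) (All.lookup τ≢ σ∈)) (occurrences-census f unique σ∈))

  fromColours : (τs : List (Colour r)) → Structure r (length τs)
  fromColours τs = tabulate λ i → tabulate λ v → lookup (List.lookup τs v) i

  frequency-fromColours : ∀ τs σ → frequency (fromColours τs) everywhere σ ≡ occurrences σ τs
  frequency-fromColours τs σ = count-cong λ v → cong (λ τ → does (τ ≟ᶜ σ)) (lookup-ext {xs = colour (fromColours τs) v} {List.lookup τs v} (at v))
    where
    at : ∀ v i → lookup (colour (fromColours τs) v) i ≡ lookup (List.lookup τs v) i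
    at v i = trans (lookup-colour (fromColours τs) i v)
      (trans (cong (λ R → lookup R v) (lookup∘tabulate _ i)) (lookup∘tabulate _ v))

allColours : ∀ r → List (Colour r)
allColours zero    = [] ∷ []
allColours (suc r) = map (true ∷_) (allColours r) ++ map (false ∷_) (allColours r)

allColours-complete : ∀ {r} (τ : Colour r) → τ ∈ allColours r
allColours-complete []          = here refl
allColours-complete (true  ∷ τ) = ∈-++⁺ˡ (∈-map⁺ _ (allColours-complete τ))
allColours-complete (false ∷ τ) = ∈-++⁺ʳ (map (true ∷_) (allColours _)) (∈-map⁺ _ (allColours-complete τ))

allColours-unique : ∀ r → Unique (allColours r)
allColours-unique zero    = [] ∷ []
allColours-unique (suc r) = Unique.++⁺ (Unique.map⁺ ∷-injectiveʳ (allColours-unique r))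
                                       (Unique.map⁺ ∷-injectiveʳ (allColours-unique r)) disjoint
  where
  disjoint : ∀ {τ} → ¬ (τ ∈ map (true ∷_) (allColours r) × τ ∈ map (false ∷_) (allColours r))
  disjoint (∈t , ∈f) with _ , _ , refl ← ∈-map⁻ _ ∈t with _ , _ , () ← ∈-map⁻ _ ∈f

module _ {r : ℕ} (⊗ : Mode) (φ : Sentence r) (k : ℕ) where

  horizon : ℕ
  horizon = k + length (pattern-of φ)

  truncated : ∀ {n} → Structure r n → Colour r → ℕ
  truncated A τ = frequency A everywhere τ ⊓ horizon

  -- Evaluated while the circuit is constructed, where it supplies the constants at the bottom of
  -- `computes-census`.
  solvableFrom : List (Colour r) → Bool
  solvableFrom τs = does (solvable? ⊗ φ k (fromColours τs))

  representative : ∀ {n} → Structure r n → List (Colour r)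
  representative A = census (truncated A) (allColours r)

  -- The representative has exactly the truncated frequencies, and truncating twice is truncating
  -- once.
  similar-representative : ∀ {n} (A : Structure r n) →
    Similar horizon A everywhere (fromColours (representative A)) everywhere
  similar-representative A τ = sym (begin
    frequency (fromColours (representative A)) everywhere τ ⊓ horizon
      ≡⟨ cong (_⊓ horizon) (trans (frequency-fromColours (representative A) τ)
           (occurrences-census (truncated A) (allColours-unique r) (allColours-complete τ))) ⟩
    frequency A everywhere τ ⊓ horizon ⊓ horizon
      ≡⟨ ⊓-assoc (frequency A everywhere τ) horizon horizon ⟩
    frequency A everywhere τ ⊓ (horizon ⊓ horizon)
      ≡⟨ cong (frequency A everywhere τ ⊓_) (⊓-idem horizon) ⟩
    frequency A everywhere τ ⊓ horizon ∎)
    where open ≡-Reasoning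

  solvableFrom-sound : ∀ {n} (A : Structure r n) → solvableFrom (representative A) ≡ true → Solvable ⊗ φ k A
  solvableFrom-sound A eq = solvable-transfer ⊗ φ k {A = fromColours (representative A)} {A}
    (sym ∘ similar-representative A) (does-true (solvable? ⊗ φ k (fromColours (representative A))) eq)

  solvableFrom-complete : ∀ {n} (A : Structure r n) → Solvable ⊗ φ k A → solvableFrom (representative A) ≡ true
  solvableFrom-complete A sol = dec-true (solvable? ⊗ φ k (fromColours (representative A)))
    (solvable-transfer ⊗ φ k {A = A} {fromColours (representative A)} (similar-representative A) sol)

-- Circuits for truncated colour frequencies

module _ {N : ℕ} where

  computes-const : ∀ {d s} b → Computes {N} (suc d) (suc s) (const b)
  computes-const true  = computes-mono (s≤s z≤n) (s≤s z≤n) (computes-all {d = 0} {0} {λ (y : Bool) _ → y} [] (λ ()))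
  computes-const false = computes-mono (s≤s z≤n) (s≤s z≤n) (computes-any {d = 0} {0} {λ (y : Bool) _ → y} [] (λ ()))

  -- The Boolean is known at construction time, so the conjunction costs no gate beyond the given
  -- bounds: either the circuit for `f` or a constant is used.
  computes-guard : ∀ {d s f} b → Computes {N} (suc d) (suc s) f → Computes (suc d) (suc s) (λ x → b ∧ f x)
  computes-guard true  C = C
  computes-guard false C = computes-const false

  computes-∧ : ∀ {d s f g} → Computes {N} d s f → Computes d s g → Computes (suc d) (suc (2 * s)) (λ x → f x ∧ g x)
  computes-∧ {d} {s} {f} {g} F G =
    computes-≗ (λ x → cong (f x ∧_) (Bool.∧-identityʳ (g x)))
      (computes-all {F = λ b → if b then f else g} (true ∷ false ∷ []) λ {b} _ → branch b)
    where
    branch : ∀ b → Computes {N} d s (if b then f else g)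
    branch true  = F
    branch false = G

  computes-literal : ∀ i b → Computes {N} 1 1 (λ x → does (x i Bool.≟ b))
  computes-literal i true  = computes-≗ (λ x → same (x i)) (computes-mono z≤n z≤n (computes-input i))
    where
    same : ∀ b → b ≡ does (b Bool.≟ true)
    same true  = refl
    same false = refl
  computes-literal i false = computes-≗ (λ x → same (x i)) (computes-not (computes-input i))
    where
    same : ∀ b → not b ≡ does (b Bool.≟ false)
    same true  = refl
    same false = refl

censusDepth : ℕ → ℕ → ℕ
censusDepth d zero    = suc d
censusDepth d (suc l) = 2 + censusDepth d l

≤censusDepth : ∀ d l → d ≤ censusDepth d l
≤censusDepth d zero    = n≤1+n d
≤censusDepth d (suc l) = ≤-trans (≤censusDepth d l) (m≤n+m _ 2)

censusSize : ℕ → ℕ → ℕ → ℕ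
censusSize t s zero    = 1
censusSize t s (suc l) = suc (suc t * suc (2 * (s + censusSize t s l)))

-- An arbitrary property `h` of the census is tested by guessing the frequency of the first colour,
-- verifying the guess, and recursing on `h` with that many copies built in; with no colour left,
-- `h` is a constant. Each colour adds one OR and one AND level, whatever t is, while the size is
-- multiplied by a factor of order t.
computes-census : ∀ {N r d s t} {f : (Fin N → Bool) → Colour r → ℕ} →
  (∀ x τ → f x τ ≤ t) →
  (∀ τ {j} → j ≤ t → Computes d s (λ x → does (f x τ ≟ j))) →
  ∀ τs h → Computes (censusDepth d (length τs)) (censusSize t s (length τs)) (λ x → h (census (f x) τs))
computes-census f≤t C [] h = computes-const (h [])
computes-census {d = d} {s} {t} {f} f≤t C (τ ∷ τs) h =
  subst (λ m → Computes (censusDepth d (suc l)) (suc (m * suc (2 * (s + censusSize t s l)))) (λ x → h (census (f x) (τ ∷ τs))))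
    (length-upTo (suc t))
    (computes-≗ guess (computes-any (upTo (suc t)) λ {j} j∈ →
      computes-∧ (computes-mono (≤censusDepth d l) (m≤m+n s _) (C τ (≤-pred (∈-upTo⁻ j∈))))
                 (computes-mono ≤-refl (m≤n+m _ s)
                   (computes-census f≤t C τs (λ σs → h (replicate j τ ++ σs))))))
  where
  l = length τs
  guess : ∀ x → any (λ j → does (f x τ ≟ j) ∧ h (replicate j τ ++ census (f x) τs)) (upTo (suc t)) ≡ h (census (f x) (τ ∷ τs))
  guess x = bool-ext to from
    where
    right : ℕ → Bool
    right j = does (f x τ ≟ j) ∧ h (replicate j τ ++ census (f x) τs)
    to : any right (upTo (suc t)) ≡ true → h (census (f x) (τ ∷ τs)) ≡ true
    to eq
      with j , _ , rj ← any-true⁻ (upTo (suc t)) eq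
      with eqj , hj ← ∧-true⁻ (does (f x τ ≟ j)) rj
      = subst (λ j → h (replicate j τ ++ census (f x) τs) ≡ true) (sym (does-true (f x τ ≟ j) eqj)) hj
    from : h (census (f x) (τ ∷ τs)) ≡ true → any right (upTo (suc t)) ≡ true
    from hx = any-true⁺ {p = right} (∈-upTo⁺ (s≤s (f≤t x τ))) (cong₂ _∧_ (dec-true (f x τ ≟ f x τ) refl) hx)

colourSize : ℕ → ℕ
colourSize r = suc (r * 1)

meetingSize : ℕ → ℕ → ℕ
meetingSize r n = suc (n * colourSize r)

thresholdSize exactSize : ℕ → ℕ → ℕ → ℕ
thresholdSize r n d = suc ((2 + codeLength n) ^ (2 ^ d) * suc (2 ^ d * meetingSize r n))
exactSize r n d = suc (2 * suc (thresholdSize r n d))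

module _ {r n N : ℕ} (ix : Fin r → Fin n → Fin N) where

  readStructure : (Fin N → Bool) → Structure r n
  readStructure x = tabulate λ i → tabulate λ v → x (ix i v)

  bit-readStructure : ∀ x i v → bit (readStructure x) i v ≡ x (ix i v)
  bit-readStructure x i v = trans (cong (λ R → lookup R v) (lookup∘tabulate _ i)) (lookup∘tabulate _ v)

  computes-hasColour : ∀ τ v → Computes 2 (colourSize r) (λ x → hasColour (readStructure x) everywhere τ v)
  computes-hasColour τ v =
    subst (λ m → Computes 2 (suc (m * 1)) (λ x → hasColour (readStructure x) everywhere τ v)) (length-tabulate {n = r} id)
      (computes-≗ same (computes-all (allFin r) λ {i} _ → computes-literal (ix i v) (lookup τ i)))
    where
    same : ∀ x → all (λ i → does (x (ix i v) Bool.≟ lookup τ i)) (allFin r) ≡ does (colour (readStructure x) v ≟ᶜ τ)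
    same x = bool-ext
      (λ eq → dec-true (colour (readStructure x) v ≟ᶜ τ) (lookup-ext λ i →
        trans (lookup-colour (readStructure x) i v) (trans (bit-readStructure x i v)
          (does-true (x (ix i v) Bool.≟ lookup τ i) (All.lookup (all-true⁻ (allFin r) eq) (∈-allFin i))))))
      (λ eq → all-true⁺ (All.universal (λ i → dec-true (x (ix i v) Bool.≟ lookup τ i)
        (trans (sym (trans (lookup-colour (readStructure x) i v) (bit-readStructure x i v)))
          (cong (λ σ → lookup σ i) (does-true (colour (readStructure x) v ≟ᶜ τ) eq)))) (allFin r)))

  computes-meets : ∀ τ (g : Region n) →
    Computes 3 (meetingSize r n) (λ x → any (λ v → g v ∧ hasColour (readStructure x) everywhere τ v) (allFin n))
  computes-meets τ g =
    subst (λ m → Computes 3 (suc (m * colourSize r)) (λ x → any (λ v → g v ∧ hasColour (readStructure x) everywhere τ v) (allFin n))) (length-tabulate {n = n} id)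
      (computes-any (allFin n) λ {v} _ → computes-guard (g v) (computes-hasColour τ v))

  -- Some tree, every leaf of it, some element of the leaf: three levels on top of the colour test
  -- of depth 2.
  computes-threshold : ∀ d τ {t} → t ≤ d →
    Computes 5 (thresholdSize r n d) (λ x → does (t ≤? frequency (readStructure x) everywhere τ))
  computes-threshold d τ {t} t≤d = computes-≗ same
    (computes-mono ≤-refl (s≤s (*-monoˡ-≤ (suc (2 ^ d * meetingSize r n)) (length-splittings code d)))
      -- Trees with fewer than t leaves are struck out by a constant; trees with more prove even
      -- more than is asked.
      (computes-any (splittings code d) λ {F} F∈ → computes-guard (does (t ≤? length F))
        (computes-mono ≤-refl (s≤s (*-monoˡ-≤ (meetingSize r n) (length-member≤ code d F∈)))
          (computes-all F λ {g} _ → computes-meets τ g))))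
    where
    met : (Fin N → Bool) → Region n → Bool
    met x g = any (λ v → g v ∧ hasColour (readStructure x) everywhere τ v) (allFin n)
    same : ∀ x → any (λ F → does (t ≤? length F) ∧ all (met x) F) (splittings code d)
                 ≡ does (t ≤? frequency (readStructure x) everywhere τ)
    same x = bool-ext to from
      where
      reached : List (Region n) → Bool
      reached F = does (t ≤? length F) ∧ all (met x) F
      to : any reached (splittings code d) ≡ true → does (t ≤? frequency (readStructure x) everywhere τ) ≡ true
      to eq
        with F , F∈ , eqF ← any-true⁻ (splittings code d) eq
        with t≤F , metF ← ∧-true⁻ (does (t ≤? length F)) eqF
        = dec-true (t ≤? _) (≤-trans (does-true (t ≤? length F) t≤F)
            (meets-all⇒length≤count code d F∈ _ (All.map
              (λ eqg → let v , _ , eqv = any-true⁻ (allFin n) eqg in v , eqv) (all-true⁻ F metF))))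
      from : does (t ≤? frequency (readStructure x) everywhere τ) ≡ true → any reached (splittings code d) ≡ true
      from eq
        with F , F∈ , F≡t , meets ← meeting-splitting code code-separating d _ t≤d (does-true (t ≤? _) eq)
        = any-true⁺ {p = reached} F∈ (cong₂ _∧_ (dec-true (t ≤? length F) (≤-reflexive (sym F≡t)))
            (all-true⁺ (All.map (λ (v , eqv) → any-true⁺ (∈-allFin v) eqv) meets)))

  -- Below the cap, the value t means at least t and not at least t + 1; the NOT and the AND raise
  -- the depth from 5 to 7. At the cap one threshold is enough, so d + 1 elements are never asked
  -- for, beyond what `meeting-splitting` guarantees at depth `d`.
  computes-exact : ∀ d τ {t} → t ≤ d →
    Computes 7 (exactSize r n d) (λ x → does (frequency (readStructure x) everywhere τ ⊓ d ≟ t))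
  computes-exact d τ {t} t≤d with m≤n⇒m<n∨m≡n t≤d
  ... | inj₁ t<d = computes-≗ (λ x → exact (frequency (readStructure x) everywhere τ))
    (computes-∧ (computes-mono (n≤1+n 5) (n≤1+n _) (computes-threshold d τ t≤d))
                (computes-not (computes-threshold d τ t<d)))
    where
    exact : ∀ c → does (t ≤? c) ∧ not (does (suc t ≤? c)) ≡ does (c ⊓ d ≟ t)
    exact c with <-cmp c t
    ... | tri< c<t _ _ = trans (cong (_∧ not (does (suc t ≤? c))) (dec-false (t ≤? c) (<⇒≱ c<t)))
      (sym (dec-false (c ⊓ d ≟ t) λ eq → <⇒≱ c<t (≤-trans (≤-reflexive (sym eq)) (m⊓n≤m c d))))
    ... | tri≈ _ refl _ = trans (cong₂ (λ p q → p ∧ not q) (dec-true (t ≤? t) ≤-refl) (dec-false (suc t ≤? t) 1+n≰n))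
      (sym (dec-true (t ⊓ d ≟ t) (m≤n⇒m⊓n≡m t≤d)))
    ... | tri> _ _ t<c = trans (cong₂ (λ p q → p ∧ not q) (dec-true (t ≤? c) (<⇒≤ t<c)) (dec-true (suc t ≤? c) t<c))
      (sym (dec-false (c ⊓ d ≟ t) λ eq → <-irrefl (sym eq) (⊓-pres-m< t<c t<d)))
  ... | inj₂ refl = computes-≗ (λ x → exact (frequency (readStructure x) everywhere τ))
    (computes-mono (m≤m+n 5 2) (≤-trans (n≤1+n _) (m≤n⇒m≤1+n (m≤m+n _ _))) (computes-threshold d τ ≤-refl))
    where
    exact : ∀ c → does (t ≤? c) ≡ does (c ⊓ t ≟ t)
    exact c = bool-ext (λ eq → dec-true (c ⊓ t ≟ t) (m≥n⇒m⊓n≡n (does-true (t ≤? c) eq)))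
                       (λ eq → dec-true (t ≤? c) (m⊓n≡n⇒n≤m (does-true (c ⊓ t ≟ t) eq)))

-- The decision circuits

solverSize : ℕ → ℕ → ℕ → ℕ → ℕ
solverSize r q n k = suc (2 * (suc (n * 0) + censusSize (k + q) (exactSize r n (k + q)) (length (allColours r))))

solverDepth : ℕ → ℕ
solverDepth r = suc (censusDepth 7 (length (allColours r)))

tractable-censusSize : ∀ {t s} → Computable t → Tractable s → ∀ l → Tractable (λ n k → censusSize (t k) (s n k) l)
tractable-censusSize ct ts zero    = tractable-const 1
tractable-censusSize ct ts (suc l) = tractable-suc
  (tractable-* (tractable-suc (tractable-param ct))
    (tractable-suc (tractable-* (tractable-const 2) (tractable-+ ts (tractable-censusSize ct ts l)))))

tractable-solverSize : ∀ r q → Tractable (solverSize r q)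
tractable-solverSize r q =
  tractable-suc (tractable-* (tractable-const 2) (tractable-+
    (tractable-suc (tractable-* tractable-size (tractable-const 0)))
    (tractable-censusSize horizon-computable exact (length (allColours r)))))
  where
  horizon-computable : Computable (λ k → k + q)
  horizon-computable = computable-+ computable-id (computable-const q)
  power-computable : Computable (λ k → 2 ^ (k + q))
  power-computable = computable-^ (computable-const 2) horizon-computable
  exact : Tractable (λ n k → exactSize r n (k + q))
  exact = tractable-suc (tractable-* (tractable-const 2) (tractable-suc (tractable-suc
    (tractable-* (tractable-logPower power-computable)
      (tractable-suc (tractable-* (tractable-param power-computable)
        (tractable-suc (tractable-* tractable-size (tractable-const (colourSize r))))))))))

lookup-toList : ∀ {X : Set} {m} (xs : Vec X m) {ys} .(eq : m ≡ length ys) → ys ≡ toList xs →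
                ∀ i → List.lookup ys (cast eq i) ≡ lookup xs i
lookup-toList (x ∷ xs) eq refl zero    = refl
lookup-toList (x ∷ xs) eq refl (suc i) = lookup-toList xs (suc-injective eq) refl i

rejecting : ∀ {N} → Circuit N
rejecting = circuit (OR [] ∷ []) (gate zero)

module _ {r : ℕ} (⊗ : Mode) (φ : Sentence r) (k : ℕ) where

  rank : ℕ
  rank = length (pattern-of φ)

  module Solver {n N : ℕ} (N≡ : N ≡ suc r * n) where

    position : Fin (suc r) → Fin n → Fin N
    position i v = cast (sym N≡) (combine i v)

    structure : (Fin N → Bool) → Structure r n
    structure = readStructure (λ i v → position (suc i) v)

    -- The first conjunct checks the leading block of ones: among strings of the right length, it is
    -- what distinguishes encodings.
    accepts : (Fin N → Bool) → Bool
    accepts x = all (λ v → x (position zero v)) (allFin n) ∧ solvableFrom ⊗ φ k (representative ⊗ φ k (structure x))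

    computes-accepts : Computes (solverDepth r) (solverSize r rank n k) accepts
    computes-accepts = computes-∧
      (computes-mono (≤-trans (s≤s z≤n) (≤censusDepth 7 (length (allColours r)))) (m≤m+n _ _)
        (subst (λ m → Computes 1 (suc (m * 0)) (λ x → all (λ v → x (position zero v)) (allFin n)))
          (length-tabulate {n = n} id) (computes-all (allFin n) λ {v} _ → computes-input (position zero v))))
      (computes-mono ≤-refl (m≤n+m _ (suc (n * 0)))
        (computes-census {f = λ x → truncated ⊗ φ k (structure x)}
          (λ x τ → m⊓n≤n _ (k + rank))
          (λ τ → computes-exact (λ i v → position (suc i) v) (k + rank) τ)
          (allColours r) (solvableFrom ⊗ φ k)))

    solver : Built [] (solverDepth r) (solverSize r rank n k) accepts
    solver = computes-accepts []

  -- An encoding consists of r + 1 blocks of equal length. Divisibility depends on the input length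
  -- alone, so it is settled when choosing the circuit.
  decider : ∀ {N} → Dec (suc r ∣ N) → Circuit N
  decider (no _)               = rejecting
  decider (yes (divides n N≡)) = circuit (Extension.gates extension) out
    where open Built (Solver.solver (trans N≡ (*-comm n (suc r))))

  depth-decider : ∀ {N} (d? : Dec (suc r ∣ N)) → depth (decider d?) ≤ solverDepth r
  depth-decider (no _)               = s≤s z≤n
  depth-decider (yes (divides n N≡)) = maxDepth≤
    where open Built (Solver.solver (trans N≡ (*-comm n (suc r))))

  size-decider : ∀ {N} (d? : Dec (suc r ∣ N)) → ∃[ n ] n ≤ N × size (decider d?) ≤ solverSize r rank n k
  size-decider {N} (no _)               = N , ≤-refl , s≤s z≤n
  size-decider {N} (yes (divides n N≡)) = n , ≤-trans (m≤m*n n (suc r)) (≤-reflexive (sym N≡))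
                                        , ≤-trans total≤ (≤-reflexive (+-identityʳ _))
    where open Built (Solver.solver (trans N≡ (*-comm n (suc r))))

  module _ (ys : List Bool) where

    module _ {n : ℕ} (N≡ : length ys ≡ suc r * n) where
      open Solver N≡

      lookup-position : ∀ (M : Structure (suc r) n) → ys ≡ toList (concat M) → ∀ i v →
                        List.lookup ys (position i v) ≡ bit M i v
      lookup-position M ys≡ i v = trans (lookup-toList (concat M) (sym N≡) ys≡ (combine i v)) (lookup-concat M i v)

      structure-encoding : ∀ {R A} → ys ≡ toList (concat (R ∷ A)) → structure (List.lookup ys) ≡ A
      structure-encoding {R} {A} ys≡ = bit-ext λ i v →
        trans (bit-readStructure _ (List.lookup ys) i v) (lookup-position (R ∷ A) ys≡ (suc i) v)

      accepts-complete : ∀ A → ys ≡ encode A → Modifiable ⊗ φ k A → accepts (List.lookup ys) ≡ true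
      accepts-complete A ys≡ mod = cong₂ _∧_
        (all-true⁺ (All.universal (λ v → trans (lookup-position (Subset.⊤ ∷ A) ys≡ zero v) (lookup-replicate v true)) (allFin n)))
        (subst (λ B → solvableFrom ⊗ φ k (representative ⊗ φ k B) ≡ true) (sym (structure-encoding {Subset.⊤} {A} ys≡))
          (solvableFrom-complete ⊗ φ k A (modifiable⇒solvable ⊗ φ k mod)))

      accepts-sound : accepts (List.lookup ys) ≡ true → RM-problem ⊗ φ (ys , k)
      accepts-sound eq
        with full-true , solvable-true ← ∧-true⁻ (all _ (allFin n)) eq
        -- Every string of suitable length is cut into blocks; `R≡` then derives from the accepted
        -- first conjunct that the leading one is full.
        with R ∷ A , grouped ← Vec.group (suc r) n (Vec.cast N≡ (fromList ys))
        = n , A , trans ys≡ (cong (λ R → toList (concat (R ∷ A))) R≡) , solvable⇒modifiable ⊗ φ k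
            (solvableFrom-sound ⊗ φ k A (subst (λ B → solvableFrom ⊗ φ k (representative ⊗ φ k B) ≡ true)
              (structure-encoding {R} {A} ys≡) solvable-true))
        where
        ys≡ : ys ≡ toList (concat (R ∷ A))
        ys≡ = trans (sym (toList∘fromList ys)) (trans (sym (toList-cast N≡ (fromList ys))) (cong toList grouped))
        R≡ : R ≡ Subset.⊤
        R≡ = lookup-ext λ v → trans (sym (lookup-position (R ∷ A) ys≡ zero v))
          (trans (All.lookup (all-true⁻ (allFin n) full-true) (∈-allFin v)) (sym (lookup-replicate v true)))

    length-encode : ∀ {n} (A : Structure r n) → ys ≡ encode A → length ys ≡ suc r * n
    length-encode A refl = length-toList (concat (Subset.⊤ ∷ A))

    decider-complete : ∀ d? → RM-problem ⊗ φ (ys , k) → eval (decider d?) (List.lookup ys) ≡ true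
    decider-complete (no ∤N) (n , A , ys≡ , mod) =
      contradiction (divides n (trans (length-encode A ys≡) (*-comm (suc r) n))) ∤N
    decider-complete (yes (divides n N≡)) (n′ , A , ys≡ , mod) =
      -- The universe of the encoded structure has the size that division found, because the number
      -- of blocks is nonzero.
      same-size (*-cancelʳ-≡ n n′ (suc r) (trans (sym N≡) (trans (length-encode A ys≡) (*-comm (suc r) n′)))) A ys≡ mod
      where
      N≡′ = trans N≡ (*-comm n (suc r))
      same-size : ∀ {n′} → n ≡ n′ → (A : Structure r n′) → ys ≡ encode A → Modifiable ⊗ φ k A →
                  eval (decider (yes (divides n N≡))) (List.lookup ys) ≡ true
      same-size refl A ys≡ mod =
        trans (Built.value-out (Solver.solver N≡′) (List.lookup ys)) (accepts-complete N≡′ A ys≡ mod)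

    decider-sound : ∀ d? → eval (decider d?) (List.lookup ys) ≡ true → RM-problem ⊗ φ (ys , k)
    decider-sound (yes (divides n N≡)) eq =
      accepts-sound (trans N≡ (*-comm n (suc r))) (trans (sym (value-out (List.lookup ys))) eq)
      where open Built (Solver.solver (trans N≡ (*-comm n (suc r))))

RM-problem∈para-AC⁰ : ∀ {r Q} ⊗ (φ : Sentence r) → Q ⊆ RM-problem ⊗ φ → RM-problem ⊗ φ ⊆ Q →
                      Tractable (solverSize r (length (pattern-of φ))) → para-AC⁰ Q
RM-problem∈para-AC⁰ {r} ⊗ φ Q⊆ ⊆Q (c , f , f-computable , size≤) =
  (λ N k → decider ⊗ φ k (suc r ∣? N)) , solverDepth r , c , f , f-computable
  , (λ N k → depth-decider ⊗ φ k (suc r ∣? N) , bound N k)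
  , λ ys k → mk⇔ (λ y∈Q → decider-complete ⊗ φ k ys (suc r ∣? length ys) (Q⊆ y∈Q))
                 (λ accepted → ⊆Q (decider-sound ⊗ φ k ys (suc r ∣? length ys) accepted))
  where
  bound : ∀ N k → size (decider ⊗ φ k (suc r ∣? N)) ≤ f k * suc N ^ c
  bound N k = let n , n≤N , ≤solverSize = size-decider ⊗ φ k (suc r ∣? N) in
    ≤-trans ≤solverSize (≤-trans (size≤ n k) (*-monoʳ-≤ (f k) (^-monoˡ-≤ c (s≤s n≤N))))

theorem3p12 : (p : Pattern) (⊗ : Mode) → p-RM-mon ⊗ p ⊆ para-AC⁰
theorem3p12 p ⊗ (r , φ , _ , Q⊆ , ⊆Q) =
  RM-problem∈para-AC⁰ ⊗ φ Q⊆ ⊆Q (tractable-solverSize r (length (pattern-of φ)))
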